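{- The fragment $\exists^{\mathfrak{D}}$ is decidable; that is, there is an algorithm that decides, for a given purely existential sentence $\phi$, whether $\mathfrak{D}\models\phi$.
   Context: Bit strings are elements of $\{\mathbf{0},\mathbf{1}\}^*$; $\varepsilon$ is the empty string. The language $\mathcal{L}_{BT}$ has constant symbols $e,0,1$, binary function symbol $\circ$, and binary relation symbol $\preceq$. The structure $\mathfrak{D}$ has universe $\{\mathbf{0},\mathbf{1}\}^*$, interprets $e,0,1$ as $\varepsilon,\mathbf{0},\mathbf{1}$, $\circ$ as concatenation, and $\preceq$ as the prefix relation. $(\exists x\preceq t)\phi$ abbreviates $\exists x[x\preceq t\wedge\phi]$. A purely existential formula is built from $s\preceq t$, $\neg s\preceq t$, $s=t$, $\neg s=t$ (terms $s,t$) using $\wedge$, $\vee$, unbounded $\exists x$ and bounded $(\exists x\preceq t)$ with $x$ not occurring in $t$. $\exists^{\mathfrak{D}}$ is the set of purely existential sentences true in $\mathfrak{D}$. -}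

module Defs where

open import Data.Bool using (Bool; true; false)
open import Data.List using (List; []; _∷_; _++_)
open import Data.Nat using (ℕ; suc)
open import Data.Fin using (Fin; zero; suc)
open import Data.Product using (Σ; _×_)
open import Data.Sum using (_⊎_)
open import Relation.Nullary using (¬_)
open import Relation.Binary.PropositionalEquality using (_≡_)

BitString : Set
BitString = List Bool

_⪯_ : BitString → BitString → Set
x ⪯ y = Σ BitString (λ z → x ++ z ≡ y)

data Term (n : ℕ) : Set where
  var  : Fin n → Term n
  e    : Term n
  𝟘    : Term n
  𝟙    : Term n
  _∘_  : Term n → Term n → Term n

-- Purely existential formulas over n free variables.
-- Bounded quantifier (∃ x ⪯ t) φ : t lives in scope n, so the bound
-- variable x (index zero in φ) cannot occur in t.
data PEForm (n : ℕ) : Set where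
  _≼_    : Term n → Term n → PEForm n
  _⋠_    : Term n → Term n → PEForm n
  _≐_    : Term n → Term n → PEForm n
  _≠_    : Term n → Term n → PEForm n
  _∧_    : PEForm n → PEForm n → PEForm n
  _∨_    : PEForm n → PEForm n → PEForm n
  ∃'     : PEForm (suc n) → PEForm n
  ∃≼     : Term n → PEForm (suc n) → PEForm n

Env : ℕ → Set
Env n = Fin n → BitString

extend : ∀ {n} → BitString → Env n → Env (suc n)
extend x ρ zero    = x
extend x ρ (suc i) = ρ i

⟦_⟧ : ∀ {n} → Term n → Env n → BitString
⟦ var i ⟧ ρ = ρ i
⟦ e ⟧ ρ = []
⟦ 𝟘 ⟧ ρ = false ∷ []
⟦ 𝟙 ⟧ ρ = true ∷ []
⟦ s ∘ t ⟧ ρ = ⟦ s ⟧ ρ ++ ⟦ t ⟧ ρ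

Sat : ∀ {n} → PEForm n → Env n → Set
Sat (s ≼ t) ρ = ⟦ s ⟧ ρ ⪯ ⟦ t ⟧ ρ
Sat (s ⋠ t) ρ = ¬ (⟦ s ⟧ ρ ⪯ ⟦ t ⟧ ρ)
Sat (s ≐ t) ρ = ⟦ s ⟧ ρ ≡ ⟦ t ⟧ ρ
Sat (s ≠ t) ρ = ¬ (⟦ s ⟧ ρ ≡ ⟦ t ⟧ ρ)
Sat (φ ∧ ψ) ρ = Sat φ ρ × Sat ψ ρ
Sat (φ ∨ ψ) ρ = Sat φ ρ ⊎ Sat ψ ρ
Sat (∃' φ) ρ = Σ BitString (λ x → Sat φ (extend x ρ))
Sat (∃≼ t φ) ρ = Σ BitString (λ x → (x ⪯ ⟦ t ⟧ ρ) × Sat φ (extend x ρ))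

ε-env : Env 0
ε-env ()

𝔇⊨_ : PEForm 0 → Set
𝔇⊨ φ = Sat φ ε-env

{-# OPTIONS --safe #-}
module Submission where

-- Positive existential sentences reduce to word equations, and these are decided by recompression (Jeż).
-- Given a solution S of U = V, split the letters into a left and a right class, and cut every word S(X) and
-- S(U) wherever two consecutive letters are neither equal nor of the form (left, right). The factors, all of
-- the form aⁱbʲ, become the new letters; the cut is local, so it suffices to replace each X by f X g, where f
-- and g are the first and last factor of S(X). A labelling that joins at least a quarter of the consecutive
-- letter pairs of the equation outweighs the letters popped from the variables: the equation stays below a
-- fixed size while S(U) gets shorter. Hence solvability is reachability in a finite graph of equations.
-- Its edges are decidable although i and j are unbounded: comparing two words of powers amounts to solving
-- linear equations over ℕ, which is again a finite reachability problem, by halving all unknowns.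

open import Defs
open import Relation.Nullary using (Dec)

open import Data.Bool.Base using (Bool; true; false; not; if_then_else_; T) renaming (_∧_ to _&&_; _∨_ to _||_; _xor_ to _⊕ᵇ_)
open import Data.Empty using (⊥-elim)
open import Data.Fin.Base using (Fin; zero; suc; _↑ˡ_; _↑ʳ_; splitAt)
open import Data.Fin.Properties using (splitAt-↑ˡ; splitAt-↑ʳ) renaming (_≟_ to _≟ᶠ_)
open import Data.List.Base using (List; []; _∷_; _++_; [_]; map; concat; concatMap; foldr; length; replicate; upTo; allFin; cartesianProduct; cartesianProductWith; mapMaybe)
open import Data.List.Properties using (length-++; ++-assoc; ++-identityʳ; ++-cancelˡ; foldr-++; ∷-injectiveʳ; ∷-injectiveˡ; map-++; length-map; concat-++; length-mapMaybe; mapMaybe-++; map-∘) renaming (≡-dec to List-≡-dec)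
open import Data.List.Membership.Propositional using (_∈_; find; lose)
open import Data.List.Membership.Propositional.Properties using (∈-∃++; ∈-++⁺ˡ; ∈-++⁺ʳ; ∈-++⁻; ∈-map⁺; ∈-cartesianProductWith⁺; ∈-cartesianProduct⁺; ∈-upTo⁺; ∈-allFin)
open import Data.List.Relation.Binary.Pointwise as Pointwise using (Pointwise; []; _∷_)
open import Data.List.Relation.Unary.All as All using (All; []; _∷_)
open import Data.List.Relation.Unary.All.Properties using (++⁺; ++⁻ʳ; map⁺; map⁻)
open import Data.List.Relation.Unary.Any as Any using (Any; here; there)
open import Data.List.Relation.Unary.Linked using (Linked; []; [-]; _∷_)
open import Data.Maybe.Base as Maybe using (Maybe; just; nothing; maybe′)
open import Data.Nat.Base using (ℕ; zero; suc; _+_; _*_; _≤_; _<_; z≤n; s≤s; s≤s⁻¹)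
open import Data.Nat.Induction using (<-rec)
open import Data.Nat.Properties using (≤-refl; ≤-trans; ≤-reflexive; +-comm; +-assoc; +-suc; +-identityʳ; +-mono-≤; +-monoʳ-≤; +-monoˡ-≤; +-cancelˡ-≤; +-cancelʳ-≤; m≤m+n; m≤n+m; n≤1+n; ≤-total; m≤n⇒m≤1+n; *-monoʳ-≤; suc-injective; m≤n⇒∃[o]m+o≡n; ≰⇒>; <⇒≱; *-cancelˡ-≤; +-mono-<; module ≤-Reasoning) renaming (_≟_ to _≟ⁿ_; _≤?_ to _≤ⁿ?_)
open import Data.Nat.ListAction using (sum)
open import Data.Nat.Solver using (module +-*-Solver)
open import Data.Product.Base using (Σ; ∃; ∃₂; _×_; _,_; proj₁; proj₂; map₂)
open import Data.Product.Properties using () renaming (≡-dec to ×-≡-dec)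
open import Data.Sum.Base using (_⊎_; inj₁; inj₂; [_,_]′) renaming (map to ⊎-map)
open import Data.Sum.Properties using () renaming (≡-dec to ⊎-≡-dec)
open import Data.Unit.Base using (⊤; tt)
open import Data.Vec.Base using (Vec; []; _∷_; lookup; tabulate)
open import Data.Vec.Properties using (lookup∘tabulate)
open import Function.Base using (id; case_of_) renaming (_∘_ to _∘′_)
open import Relation.Binary.Definitions using (DecidableEquality)
open import Relation.Binary.PropositionalEquality using (_≡_; _≢_; refl; sym; trans; cong; cong₂; subst; subst₂; module ≡-Reasoning)
open import Relation.Nullary using (¬_; yes; no; does; contradiction)
open import Relation.Nullary.Decidable using (map′; _×-dec_; _⊎-dec_)

-- Finite search and reachability

-- Neither the length of a solution nor the exponents in its factors are bounded in advance, so
-- nothing can be searched on the side of solutions; all finiteness sits in the equations. Two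
-- points keep the graph finite. The alphabet never grows: only the factors visible in the new
-- equation receive names, and all others are erased from the solution, because deleting letters
-- absent from an equation preserves its solutions. And a factor has a finite description up to
-- exponents: a left letter can pass to a right letter once and never back, so two letters and two
-- numbers determine it. Repeated letters and pairs of distinct letters are thereby compressed in
-- the same step. An edge asserts only that two words become equal for some choice of popped words
-- and named words of the form aⁱbʲ. That is already sound; factors matter for completeness alone,
-- where they supply an edge to an equation with a shorter solution. Negated atoms become positive
-- through witnesses for a failing prefix relation, and conjunctions become one equation by a coding
-- that needs no new letters.

Enumeration : Set → Set
Enumeration A = Σ (List A) λ xs → ∀ x → x ∈ xs

search : {A : Set} → Enumeration A → {P : A → Set} → (∀ x → Dec (P x)) → Dec (∃ P)
search (xs , all) P? = map′ (λ p → let x , _ , px = find p in x , px)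
  (λ (x , px) → lose (all x) px) (Any.any? P? xs)

enum-Bool : Enumeration Bool
enum-Bool = false ∷ true ∷ [] , λ { false → here refl ; true → there (here refl) }

enum-Fin : ∀ n → Enumeration (Fin n)
enum-Fin n = allFin n , ∈-allFin

enum-× : {A B : Set} → Enumeration A → Enumeration B → Enumeration (A × B)
enum-× (xs , p) (ys , q) = cartesianProduct xs ys , λ (x , y) → ∈-cartesianProduct⁺ (p x) (q y)

enum-⊎ : {A B : Set} → Enumeration A → Enumeration B → Enumeration (A ⊎ B)
enum-⊎ (xs , p) (ys , q) = map inj₁ xs ++ map inj₂ ys , λ
  { (inj₁ x) → ∈-++⁺ˡ (∈-map⁺ inj₁ (p x))
  ; (inj₂ y) → ∈-++⁺ʳ (map inj₁ xs) (∈-map⁺ inj₂ (q y)) }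

enum-Maybe : {A : Set} → Enumeration A → Enumeration (Maybe A)
enum-Maybe (xs , p) = nothing ∷ map just xs , λ
  { nothing → here refl ; (just x) → there (∈-map⁺ just (p x)) }

enum-Vec : {A : Set} → Enumeration A → ∀ n → Enumeration (Vec A n)
enum-Vec _ zero = [] ∷ [] , λ { [] → here refl }
enum-Vec (xs , p) (suc n) = let yss , q = enum-Vec (xs , p) n in
  cartesianProductWith _∷_ xs yss , λ { (y ∷ ys) → ∈-cartesianProductWith⁺ _∷_ (p y) (q ys) }

words≤ : {A : Set} → List A → ℕ → List (List A)
words≤ xs zero = [] ∷ []
words≤ xs (suc n) = [] ∷ cartesianProductWith _∷_ xs (words≤ xs n)

∈-words≤ : {A : Set} ((xs , _) : Enumeration A) → ∀ n w → length w ≤ n → w ∈ words≤ xs n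
∈-words≤ E zero [] _ = here refl
∈-words≤ E (suc n) [] _ = here refl
∈-words≤ E (suc n) (a ∷ w) (s≤s l) = there (∈-cartesianProductWith⁺ _∷_ (proj₂ E a) (∈-words≤ E n w l))

-- The number in `Sol` is a measure: every solvable state that is not a base state has an edge to a
-- state with a smaller measure. `Inv` confines these descents to the finite list `states`.
module Saturation {S : Set} {Base : S → Set} {Step : S → S → Set}
  (base? : ∀ s → Dec (Base s)) (step? : ∀ s t → Dec (Step s t))
  {Sol : S → ℕ → Set} {Inv : S → Set}
  (base-sound : ∀ {s} → Base s → ∃ (Sol s))
  (step-sound : ∀ {s t} → Step s t → ∃ (Sol t) → ∃ (Sol s))
  (complete : ∀ {s n} → Inv s → Sol s n →
    Base s ⊎ ∃ λ t → Step s t × Inv t × ∃ λ m → m < n × Sol t m)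
  (states : List S) (covers : ∀ {s} → Inv s → s ∈ states) where

  Ready : List S → S → Set
  Ready W s = Base s ⊎ Any (Step s) W

  ready? : ∀ W s → Dec (Ready W s)
  ready? W s = base? s ⊎-dec Any.any? (step? s) W

  ready-sound : ∀ {W s} → All (∃ ∘′ Sol) W → Ready W s → ∃ (Sol s)
  ready-sound solved (inj₁ b) = base-sound b
  ready-sound solved (inj₂ p) = let t , t∈W , st = find p in step-sound st (All.lookup solved t∈W)

  Saturated : List S → List S → Set
  Saturated W R = All (∃ ∘′ Sol) W × (∀ {s} → s ∈ R → ¬ Ready W s)

  -- Backward reachability: `W` holds states known to be solvable, `R` the undecided ones. Each
  -- round moves one state from `R` to `W`, so the length of `R` is enough fuel.
  saturate : ∀ k W R → length R ≤ k → All (∃ ∘′ Sol) W →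
    ∃₂ λ W′ R′ → Saturated W′ R′ × (∀ {s} → s ∈ W ⊎ s ∈ R → s ∈ W′ ⊎ s ∈ R′)
  saturate k W R l solved with Any.any? (ready? W) R
  ... | no ¬p = W , R , (solved , λ s∈R r → ¬p (lose s∈R r)) , id
  saturate zero W [] l solved | yes ()
  saturate (suc k) W R l solved | yes p with find p
  ... | s , s∈R , r with ∈-∃++ s∈R
  ... | xs , ys , refl =
    let W′ , R′ , sat , keeps = saturate k (s ∷ W) (xs ++ ys) l′ (ready-sound solved r ∷ solved)
    in W′ , R′ , sat , λ t∈ → keeps (move t∈)
    where
    l′ : length (xs ++ ys) ≤ k
    l′ = s≤s⁻¹ (≤-trans (≤-reflexive (begin
      suc (length (xs ++ ys))       ≡⟨ cong suc (length-++ xs) ⟩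
      suc (length xs + length ys)   ≡⟨ sym (+-suc (length xs) (length ys)) ⟩
      length xs + suc (length ys)   ≡⟨ sym (length-++ xs) ⟩
      length (xs ++ s ∷ ys)         ∎)) l)
      where open ≡-Reasoning
    move : ∀ {t} → t ∈ W ⊎ t ∈ xs ++ s ∷ ys → t ∈ s ∷ W ⊎ t ∈ xs ++ ys
    move (inj₁ t∈W) = inj₁ (there t∈W)
    move (inj₂ t∈) with ∈-++⁻ xs t∈
    ... | inj₁ t∈xs = inj₂ (∈-++⁺ˡ t∈xs)
    ... | inj₂ (here refl) = inj₁ (here refl)
    ... | inj₂ (there t∈ys) = inj₂ (∈-++⁺ʳ xs t∈ys)

  -- A solvable state left in `R` has an edge to a smaller solvable state. That state is not in `W`,
  -- as the edge would make the first one ready, and not in `R`, by induction on the measure.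
  saturated-complete : ∀ {W R} → Saturated W R → (∀ {s} → Inv s → s ∈ W ⊎ s ∈ R) →
    ∀ n {s} → s ∈ R → Inv s → ¬ Sol s n
  saturated-complete {W} {R} (_ , stuck) cover = <-rec _ go
    where
    go : ∀ n → (∀ {m} → m < n → ∀ {s} → s ∈ R → Inv s → ¬ Sol s m) →
      ∀ {s} → s ∈ R → Inv s → ¬ Sol s n
    go n rec s∈R inv sol with complete inv sol
    ... | inj₁ b = stuck s∈R (inj₁ b)
    ... | inj₂ (t , st , inv′ , m , m<n , sol′) with cover inv′
    ...   | inj₁ t∈W = stuck s∈R (inj₂ (lose t∈W st))
    ...   | inj₂ t∈R = rec m<n t∈R inv′ sol′

  decide : ∀ {s} → Inv s → Dec (∃ (Sol s))
  decide inv with saturate (length states) [] states ≤-refl []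
  ... | W , R , sat , keeps with keeps (inj₂ (covers inv))
  ... | inj₁ s∈W = yes (All.lookup (proj₁ sat) s∈W)
  ... | inj₂ s∈R = no λ (n , sol) →
    saturated-complete sat (λ i → keeps (inj₂ (covers i))) n s∈R inv sol

-- Linear equations over ℕ

-- A linear polynomial with its coefficients in unary: the coefficient of an unknown is its
-- multiplicity in the list.
Exponent : ℕ → Set
Exponent m = ℕ × List (Fin m)

total : ∀ {m} → (Fin m → ℕ) → List (Fin m) → ℕ
total κ l = sum (map κ l)

value : ∀ {m} → (Fin m → ℕ) → Exponent m → ℕ
value κ (c , l) = total κ l + c

Equation : ℕ → Set
Equation m = Exponent m × Exponent m

Holds : ∀ {m} → (Fin m → ℕ) → Equation m → Set
Holds κ (p , q) = value κ p ≡ value κ q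

bit : Bool → ℕ
bit false = 0
bit true  = 1

halve : ∀ n → ∃₂ λ b h → n ≡ bit b + (h + h)
halve zero = false , 0 , refl
halve (suc n) with halve n
... | false , h , refl = true , h , refl
... | true  , h , refl = false , suc h , cong suc (sym (+-suc h h))

m+m≢1+n+n : ∀ m n → m + m ≢ suc (n + n)
m+m≢1+n+n (suc m) n eq = m+m≢1+n+n n m (sym (suc-injective (trans (cong suc (sym (+-suc m m))) eq)))

m+m-injective : ∀ m n → m + m ≡ n + n → m ≡ n
m+m-injective zero zero _ = refl
m+m-injective (suc m) (suc n) eq = cong suc (m+m-injective m n (suc-injective (suc-injective
  (trans (cong suc (sym (+-suc m m))) (trans eq (cong suc (+-suc n n)))))))

bit-double-injective : ∀ b c m n → bit b + (m + m) ≡ bit c + (n + n) → b ≡ c × m ≡ n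
bit-double-injective false false m n eq = refl , m+m-injective m n eq
bit-double-injective true  true  m n eq = refl , m+m-injective m n (suc-injective eq)
bit-double-injective false true  m n eq = ⊥-elim (m+m≢1+n+n m n eq)
bit-double-injective true  false m n eq = ⊥-elim (m+m≢1+n+n n m (sym eq))

m+m≤n+n⇒m≤n : ∀ m n → m + m ≤ n + n → m ≤ n
m+m≤n+n⇒m≤n m n l with m ≤ⁿ? n
... | yes m≤n = m≤n
... | no m≰n = contradiction l (<⇒≱ (+-mono-< (≰⇒> m≰n) (≰⇒> m≰n)))

bits : ∀ {m} → Vec Bool m → Fin m → ℕ
bits ε i = bit (lookup ε i)

total-bits≤length : ∀ {m} (ε : Vec Bool m) l → total (bits ε) l ≤ length l
total-bits≤length ε [] = z≤n
total-bits≤length ε (i ∷ l) with lookup ε i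
... | false = m≤n⇒m≤1+n (total-bits≤length ε l)
... | true  = s≤s (total-bits≤length ε l)

total-zero : ∀ {m} {κ : Fin m → ℕ} → (∀ i → κ i ≡ 0) → ∀ l → total κ l ≡ 0
total-zero z [] = refl
total-zero z (i ∷ l) rewrite z i = total-zero z l

record Binary {m} (κ : Fin m → ℕ) (ε : Vec Bool m) (κ′ : Fin m → ℕ) : Set where
  constructor binary-at
  field at : ∀ i → κ i ≡ bits ε i + (κ′ i + κ′ i)
open Binary

total-binary : ∀ {m} {κ κ′ : Fin m → ℕ} {ε} → Binary κ ε κ′ → ∀ l →
  total κ l ≡ total (bits ε) l + (total κ′ l + total κ′ l)
total-binary bin [] = refl
total-binary {κ = κ} {κ′} {ε} bin (i ∷ l) rewrite at bin i | total-binary {κ = κ} {κ′} bin l =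
  solve 4 (λ b k t s → (b :+ (k :+ k)) :+ (t :+ (s :+ s)) := (b :+ t) :+ ((k :+ s) :+ (k :+ s)))
    refl (bits ε i) (κ′ i) (total (bits ε) l) (total κ′ l)
  where open +-*-Solver

-- If every unknown is written as κ i = εᵢ + 2 κ′ i, the value of an exponent is
-- p + 2 · (value under κ′ of an exponent with the same coefficients).
Halved : ∀ {m} → Vec Bool m → Bool → Exponent m → Exponent m → Set
Halved ε p (c , l) (c′ , l′) = l ≡ l′ × total (bits ε) l + c ≡ bit p + (c′ + c′)

halved? : ∀ {m} (ε : Vec Bool m) p q q′ → Dec (Halved ε p q q′)
halved? ε p (c , l) (c′ , l′) =
  List-≡-dec _≟ᶠ_ l l′ ×-dec (total (bits ε) l + c ≟ⁿ bit p + (c′ + c′))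

value-halved : ∀ {m} {κ κ′ : Fin m → ℕ} {ε q q′} p → Binary κ ε κ′ → Halved ε p q q′ →
  value κ q ≡ bit p + (value κ′ q′ + value κ′ q′)
value-halved {κ = κ} {κ′} {ε} {c , l} {c′ , _} p bin (refl , eq) = begin
  total κ l + c                ≡⟨ cong (_+ c) (total-binary {κ = κ} {κ′} bin l) ⟩
  total (bits ε) l + (s + s) + c ≡⟨ solve 3 (λ t s c → t :+ (s :+ s) :+ c := t :+ c :+ (s :+ s)) refl (total (bits ε) l) s c ⟩
  total (bits ε) l + c + (s + s) ≡⟨ cong (_+ (s + s)) eq ⟩
  bit p + (c′ + c′) + (s + s)  ≡⟨ solve 3 (λ b c s → b :+ (c :+ c) :+ (s :+ s) := b :+ ((s :+ c) :+ (s :+ c))) refl (bit p) c′ s ⟩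
  bit p + ((s + c′) + (s + c′)) ∎
  where
  open ≡-Reasoning
  open +-*-Solver
  s = total κ′ l

HalvedEq : ∀ {m} → Vec Bool m → Equation m → Equation m → Set
HalvedEq ε (q , r) (q′ , r′) = ∃ λ p → Halved ε p q q′ × Halved ε p r r′

-- A transition of the automaton that reads the binary digits of all unknowns, least significant
-- first. `ε` lists the digits read, and the constants of the equations act as carries.
LinStep : ∀ {m} → List (Equation m) → List (Equation m) → Set
LinStep {m} es es′ = ∃ λ (ε : Vec Bool m) → Pointwise (HalvedEq ε) es es′

linStep? : ∀ {m} (es es′ : List (Equation m)) → Dec (LinStep es es′)
linStep? es es′ = search (enum-Vec enum-Bool _) λ ε → Pointwise.decidable
  (λ (q , r) (q′ , r′) → search enum-Bool λ p → halved? ε p q q′ ×-dec halved? ε p r r′) es es′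

LinBase : ∀ {m} → List (Equation m) → Set
LinBase = All λ ((c , _) , (d , _)) → c ≡ d

-- The common bound `n` on the unknowns is the measure: halving lowers it, and at bound zero all
-- unknowns vanish, so that only the constants remain to be compared.
LinSol : ∀ {m} → List (Equation m) → ℕ → Set
LinSol {m} es n = ∃ λ (κ : Fin m → ℕ) → (∀ i → κ i ≤ n) × All (Holds κ) es

bounded : ∀ {m} (κ : Fin m → ℕ) → ∃ λ n → ∀ i → κ i ≤ n
bounded {zero} κ = 0 , λ ()
bounded {suc m} κ = let n , le = bounded (λ i → κ (suc i)) in κ zero + n ,
  λ { zero → m≤m+n (κ zero) n ; (suc i) → ≤-trans (le i) (m≤n+m n (κ zero)) }

holds-zero : ∀ {m} {κ : Fin m → ℕ} → (∀ i → κ i ≡ 0) → ∀ {es} → LinBase es → All (Holds κ) es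
holds-zero z = All.map λ { {(c , l) , (d , r)} refl → cong (_+ c) (trans (total-zero z l) (sym (total-zero z r))) }

zero-holds : ∀ {m} {κ : Fin m → ℕ} → (∀ i → κ i ≡ 0) → ∀ {es} → All (Holds κ) es → LinBase es
zero-holds z = All.map λ { {(c , l) , (d , r)} h →
  trans (sym (cong (_+ c) (total-zero z l))) (trans h (cong (_+ d) (total-zero z r))) }

holds-halved : ∀ {m} {κ κ′ : Fin m → ℕ} {ε} → Binary κ ε κ′ → ∀ {es es′} →
  Pointwise (HalvedEq ε) es es′ → All (Holds κ′) es′ → All (Holds κ) es
holds-halved bin [] [] = []
holds-halved {κ = κ} {κ′} bin {(q , r) ∷ _} {(q′ , r′) ∷ _} ((p , hq , hr) ∷ st) (h ∷ hs) =
  trans (value-halved {q = q} {q′} p bin hq)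
    (trans (cong (λ v → bit p + (v + v)) h) (sym (value-halved {q = r} {r′} p bin hr)))
  ∷ holds-halved bin st hs

WithinSide : ∀ {m} → ℕ → Exponent m → Exponent m → Set
WithinSide B (_ , l₀) (c , l) = l ≡ l₀ × c ≤ B × length l ≤ B

Within : ∀ {m} → ℕ → Equation m → Equation m → Set
Within B (q₀ , r₀) (q , r) = WithinSide B q₀ q × WithinSide B r₀ r

-- The digits contribute at most one per entry of the list, hence at most `B`; with an old constant
-- of at most `B`, half of the sum is again at most `B`. This invariance makes the state space
-- finite.
halved-exists : ∀ {m B} (ε : Vec Bool m) {q₀ q} → WithinSide B q₀ q →
  ∃₂ λ p q′ → Halved ε p q q′ × WithinSide B q₀ q′
halved-exists {B = B} ε {q = c , l} (refl , c≤B , l≤B) with halve (total (bits ε) l + c)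
... | p , h , eq = p , (h , l) , (refl , eq) , refl , m+m≤n+n⇒m≤n h B (begin
  h + h                 ≤⟨ m≤n+m (h + h) (bit p) ⟩
  bit p + (h + h)       ≡⟨ sym eq ⟩
  total (bits ε) l + c  ≤⟨ +-mono-≤ (≤-trans (total-bits≤length ε l) l≤B) c≤B ⟩
  B + B                 ∎) , l≤B
  where open ≤-Reasoning

linStep-exists : ∀ {m B} {κ κ′ : Fin m → ℕ} {ε} → Binary κ ε κ′ → ∀ {es₀ es} →
  Pointwise (Within B) es₀ es → All (Holds κ) es →
  ∃ λ es′ → Pointwise (HalvedEq ε) es es′ × Pointwise (Within B) es₀ es′ × All (Holds κ′) es′
linStep-exists bin [] [] = [] , [] , [] , []
linStep-exists {κ = κ} {κ′} {ε} bin {(q₀ , r₀) ∷ _} {(q , r) ∷ _} ((wq , wr) ∷ ws) (h ∷ hs)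
  with halved-exists ε {q₀} wq | halved-exists ε {r₀} wr | linStep-exists {κ = κ} {κ′} bin ws hs
... | p , q′ , hq , wq′ | p′ , r′ , hr , wr′ | es′ , st , ws′ , hs′
  -- Since the equation holds under `κ`, its sides have the same parity and equal halves; the latter
  -- is the new equation.
  with bit-double-injective p p′ (value κ′ q′) (value κ′ r′)
    (trans (sym (value-halved {q = q} {q′} p bin hq))
      (trans h (value-halved {q = r} {r′} p′ bin hr)))
... | refl , h′ = (q′ , r′) ∷ es′ , (p , hq , hr) ∷ st , (wq′ , wr′) ∷ ws′ , h′ ∷ hs′

binary : ∀ {m} (κ : Fin m → ℕ) → ∃₂ λ ε κ′ → Binary κ ε κ′
binary κ = tabulate (λ i → proj₁ (halve (κ i))) , (λ i → proj₁ (proj₂ (halve (κ i)))) , binary-at λ i →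
  trans (proj₂ (proj₂ (halve (κ i))))
    (cong (λ b → bit b + _) (sym (lookup∘tabulate (λ i → proj₁ (halve (κ i))) i)))

half≤ : ∀ b h {n} → bit b + (h + h) ≤ suc n → h ≤ n
half≤ b zero l = z≤n
half≤ b (suc h) {n} l = s≤s⁻¹ (≤-trans (s≤s (m≤n+m (suc h) h)) (≤-trans (m≤n+m _ (bit b)) l))

lin-complete : ∀ {m B n} {es₀ es : List (Equation m)} → Pointwise (Within B) es₀ es → LinSol es n →
  LinBase es ⊎ ∃ λ es′ → LinStep es es′ × Pointwise (Within B) es₀ es′ × ∃ λ n′ → n′ < n × LinSol es′ n′
lin-complete {n = zero} ws (κ , le , hs) = inj₁ (zero-holds (λ i → case le i of λ l → n≤0 l) hs)
  where
  n≤0 : ∀ {k} → k ≤ 0 → k ≡ 0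
  n≤0 z≤n = refl
lin-complete {n = suc n} ws (κ , le , hs) with binary κ
... | ε , κ′ , bin with linStep-exists {κ = κ} {κ′} bin ws hs
... | es′ , st , ws′ , hs′ = inj₂ (es′ , (ε , st) , ws′ , n , ≤-refl , κ′ ,
  (λ i → half≤ (lookup ε i) (κ′ i) (subst (_≤ suc n) (at bin i) (le i))) , hs′)

frames : ∀ {m} → ℕ → List (Equation m) → List (List (Equation m))
frames B [] = [] ∷ []
frames B (((_ , l) , (_ , r)) ∷ es) = cartesianProductWith _∷_
  (cartesianProductWith (λ c d → (c , l) , (d , r)) (upTo (suc B)) (upTo (suc B))) (frames B es)

∈-frames : ∀ {m B} {es₀ es : List (Equation m)} → Pointwise (Within B) es₀ es → es ∈ frames B es₀
∈-frames [] = here refl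
∈-frames (((refl , c≤B , _) , (refl , d≤B , _)) ∷ ws) = ∈-cartesianProductWith⁺ _∷_
  (∈-cartesianProductWith⁺ _ (∈-upTo⁺ (s≤s c≤B)) (∈-upTo⁺ (s≤s d≤B))) (∈-frames ws)

weight : ∀ {m} → List (Equation m) → ℕ
weight [] = 0
weight (((c , l) , (d , r)) ∷ es) = (c + length l) + (d + length r) + weight es

within-weight : ∀ {m B} (es : List (Equation m)) → weight es ≤ B → Pointwise (Within B) es es
within-weight [] _ = []
within-weight {B = B} (((c , l) , (d , r)) ∷ es) le =
  ((refl , ≤-trans (≤-trans (m≤m+n c _) (m≤m+n (c + length l) _)) le′ , ≤-trans (≤-trans (m≤n+m (length l) c) (m≤m+n (c + length l) _)) le′) ,
   (refl , ≤-trans (≤-trans (m≤m+n d _) (m≤n+m (d + length r) (c + length l))) le′ , ≤-trans (≤-trans (m≤n+m (length r) d) (m≤n+m (d + length r) (c + length l))) le′))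
  ∷ within-weight es (≤-trans (m≤n+m (weight es) _) le)
  where
  le′ : (c + length l) + (d + length r) ≤ B
  le′ = ≤-trans (m≤m+n _ (weight es)) le

lin-base-sound : ∀ {m} {es : List (Equation m)} → LinBase es → ∃ (LinSol es)
lin-base-sound base = 0 , (λ _ → 0) , (λ _ → z≤n) , holds-zero (λ _ → refl) base

lin-step-sound : ∀ {m} {es es′ : List (Equation m)} → LinStep es es′ → ∃ (LinSol es′) → ∃ (LinSol es)
lin-step-sound (ε , st) (_ , κ′ , _ , hs) =
  let κ = λ i → bits ε i + (κ′ i + κ′ i) ; n , le = bounded κ
  in n , κ , le , holds-halved {κ = κ} {κ′} {ε} (binary-at λ _ → refl) st hs

linear? : ∀ {m} (es : List (Equation m)) → Dec (∃ λ (κ : Fin m → ℕ) → All (Holds κ) es)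
linear? es = map′ (λ (n , κ , _ , hs) → κ , hs)
  (λ (κ , hs) → let n , le = bounded κ in n , κ , le , hs)
  (Saturation.decide (All.all? (λ ((c , _) , (d , _)) → c ≟ⁿ d)) linStep?
    {LinSol} {Pointwise (Within (weight es)) es} lin-base-sound lin-step-sound lin-complete
    (frames (weight es) es) ∈-frames (within-weight es ≤-refl))

-- Words of powers with unknown exponents

lift : ∀ {m} → Exponent m → Exponent (suc m)
lift (c , l) = c , map suc l

liftWith : ∀ {m} → Exponent m → Exponent (suc m)
liftWith (c , l) = c , zero ∷ map suc l

value-lift : ∀ {m} (κ : Fin (suc m) → ℕ) q → value κ (lift q) ≡ value (κ ∘′ suc) q
value-lift κ (c , l) = cong (λ ks → sum ks + c) (sym (map-∘ l))

value-liftWith : ∀ {m} (κ : Fin (suc m) → ℕ) q → value κ (liftWith q) ≡ value (κ ∘′ suc) q + κ zero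
value-liftWith κ (c , l) = begin
  κ zero + total κ (map suc l) + c   ≡⟨ +-assoc (κ zero) _ c ⟩
  κ zero + (total κ (map suc l) + c) ≡⟨ cong (κ zero +_) (value-lift κ (c , l)) ⟩
  κ zero + value (κ ∘′ suc) (c , l)  ≡⟨ +-comm (κ zero) _ ⟩
  value (κ ∘′ suc) (c , l) + κ zero  ∎
  where open ≡-Reasoning

liftEq : ∀ {m} → Equation m → Equation (suc m)
liftEq (p , q) = lift p , lift q

holds-lift : ∀ {m} (κ : Fin (suc m) → ℕ) e → Holds κ (liftEq e) ≡ Holds (κ ∘′ suc) e
holds-lift κ (p , q) = cong₂ _≡_ (value-lift κ p) (value-lift κ q)

replicate-head : {A : Set} {a b : A} → a ≢ b → ∀ i j {X Y : List A} →
  replicate i a ++ X ≡ replicate j b ++ Y → i ≡ 0 ⊎ j ≡ 0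
replicate-head a≢b zero j _ = inj₁ refl
replicate-head a≢b (suc i) zero _ = inj₂ refl
replicate-head a≢b (suc i) (suc j) eq = contradiction (∷-injectiveˡ eq) a≢b

replicate-+ : {A : Set} (a : A) (i j : ℕ) (X : List A) →
  replicate (i + j) a ++ X ≡ replicate i a ++ replicate j a ++ X
replicate-+ a zero j X = refl
replicate-+ a (suc i) j X = cong (a ∷_) (replicate-+ a i j X)

module Parametric {A : Set} (_≟_ : DecidableEquality A) where

  PWord : ℕ → Set
  PWord m = List (A × Exponent m)

  spell : ∀ {m} → (Fin m → ℕ) → PWord m → List A
  spell κ [] = []
  spell κ ((a , q) ∷ W) = replicate (value κ q) a ++ spell κ W

  PEquation : ℕ → Set
  PEquation m = PWord m × PWord m

  Spells : ∀ {m} → (Fin m → ℕ) → PEquation m → Set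
  Spells κ (W , W′) = spell κ W ≡ spell κ W′

  liftWord : ∀ {m} → PWord m → PWord (suc m)
  liftWord = map (map₂ lift)

  liftPEq : ∀ {m} → PEquation m → PEquation (suc m)
  liftPEq (W , W′) = liftWord W , liftWord W′

  spell-lift : ∀ {m} (κ : Fin (suc m) → ℕ) W → spell κ (liftWord W) ≡ spell (κ ∘′ suc) W
  spell-lift κ [] = refl
  spell-lift κ ((a , q) ∷ W) = cong₂ (λ i X → replicate i a ++ X) (value-lift κ q) (spell-lift κ W)

  spells-lift : ∀ {m} (κ : Fin (suc m) → ℕ) e → Spells κ (liftPEq e) ≡ Spells (κ ∘′ suc) e
  spells-lift κ (W , W′) = cong₂ _≡_ (spell-lift κ W) (spell-lift κ W′)

  size : ∀ {m} → List (PEquation m) → ℕ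
  size [] = 0
  size ((W , W′) ∷ ws) = suc (length W + length W′ + size ws)

  size-lift : ∀ {m} (ws : List (PEquation m)) → size (map liftPEq ws) ≡ size ws
  size-lift [] = refl
  size-lift ((W , W′) ∷ ws)
    rewrite length-map (map₂ lift) W | length-map (map₂ lift) W′ | size-lift ws = refl

  Solution : ∀ {m} → List (Equation m) → List (PEquation m) → (Fin m → ℕ) → Set
  Solution es ws κ = All (Holds κ) es × All (Spells κ) ws

  Solvable : ∀ {m} → List (Equation m) → List (PEquation m) → Set
  Solvable es ws = ∃ (Solution es ws)

  IsZero : ∀ {m} → Exponent m → Equation m
  IsZero q = q , (0 , [])

  dropˡ : ∀ {m} {κ : Fin m → ℕ} {a} q {W : PWord m} {X} → value κ q ≡ 0 →
    (spell κ ((a , q) ∷ W) ≡ X) ≡ (spell κ W ≡ X)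
  dropˡ {κ = κ} {a} q {W} {X} z = cong (λ i → replicate i a ++ spell κ W ≡ X) z

  dropʳ : ∀ {m} {κ : Fin m → ℕ} {a} q {W : PWord m} {X} → value κ q ≡ 0 →
    (X ≡ spell κ ((a , q) ∷ W)) ≡ (X ≡ spell κ W)
  dropʳ {κ = κ} {a} q {W} {X} z = cong (λ i → X ≡ replicate i a ++ spell κ W) z

  -- Two powers of the same letter with q ≥ q′: the excess q - q′ becomes a new unknown, with index zero.
  module Excess {m} (a : A) (q q′ : Exponent m) (W W′ : PWord m)
    (es : List (Equation m)) (ws : List (PEquation m)) where

    es⁺ : List (Equation (suc m))
    es⁺ = (lift q , liftWith q′) ∷ map liftEq es

    rest : PWord (suc m)
    rest = (a , (0 , zero ∷ [])) ∷ liftWord W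

    restore : ∀ {κ : Fin (suc m) → ℕ} → value (κ ∘′ suc) q ≡ value (κ ∘′ suc) q′ + κ zero →
      spell (κ ∘′ suc) ((a , q) ∷ W) ≡ replicate (value (κ ∘′ suc) q′) a ++ spell κ rest
    restore {κ} eq = begin
      replicate (value κ′ q) a ++ spell κ′ W                ≡⟨ cong (λ i → replicate i a ++ spell κ′ W) eq ⟩
      replicate (value κ′ q′ + κ zero) a ++ spell κ′ W      ≡⟨ replicate-+ a (value κ′ q′) (κ zero) (spell κ′ W) ⟩
      replicate (value κ′ q′) a ++ replicate (κ zero) a ++ spell κ′ W
        ≡⟨ cong₂ (λ i X → replicate (value κ′ q′) a ++ replicate i a ++ X)
             (sym (trans (+-identityʳ _) (+-identityʳ _))) (sym (spell-lift κ W)) ⟩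
      replicate (value κ′ q′) a ++ spell κ rest ∎
      where
      open ≡-Reasoning
      κ′ : Fin m → ℕ
      κ′ = κ ∘′ suc

    excess : ∀ {κ : Fin (suc m) → ℕ} → All (Holds κ) es⁺ → All (Spells κ) (map liftPEq ws) →
      value (κ ∘′ suc) q ≡ value (κ ∘′ suc) q′ + κ zero × Solution es ws (κ ∘′ suc)
    excess {κ} (h ∷ hs) ss = trans (sym (value-lift κ q)) (trans h (value-liftWith κ q′)) ,
      All.map (λ {e} → subst id (holds-lift κ e)) (map⁻ hs) ,
      All.map (λ {e} → subst id (spells-lift κ e)) (map⁻ ss)

    module _ {κ : Fin m → ℕ} {o : ℕ} (eq : value κ q′ + o ≡ value κ q) where

      κ⁺ : Fin (suc m) → ℕ
      κ⁺ zero = o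
      κ⁺ (suc i) = κ i

      es⁺-holds : All (Holds κ) es → All (Holds κ⁺) es⁺
      es⁺-holds hs = trans (value-lift κ⁺ q) (trans (sym eq) (sym (value-liftWith κ⁺ q′))) ∷
        map⁺ (All.map (λ {e} → subst id (sym (holds-lift κ⁺ e))) hs)

      ws⁺-spell : All (Spells κ) ws → All (Spells κ⁺) (map liftPEq ws)
      ws⁺-spell ss = map⁺ (All.map (λ {e} → subst id (sym (spells-lift κ⁺ e))) ss)

      cancel : spell κ ((a , q) ∷ W) ≡ spell κ ((a , q′) ∷ W′) → spell κ⁺ rest ≡ spell κ⁺ (liftWord W′)
      cancel s = ++-cancelˡ (replicate (value κ q′) a) _ _
        (trans (sym (restore {κ⁺} (sym eq))) (trans s (cong (replicate (value κ q′) a ++_) (sym (spell-lift κ⁺ W′)))))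

    excessˡ : Solvable es⁺ ((rest , liftWord W′) ∷ map liftPEq ws) →
      Solvable es (((a , q) ∷ W , (a , q′) ∷ W′) ∷ ws)
    excessˡ (κ , hs , s ∷ ss) = let eq , hs′ , ss′ = excess hs ss in
      κ ∘′ suc , hs′ , trans (restore {κ} eq)
        (cong (replicate (value (κ ∘′ suc) q′) a ++_) (trans s (spell-lift κ W′))) ∷ ss′

    excessʳ : Solvable es⁺ ((liftWord W′ , rest) ∷ map liftPEq ws) →
      Solvable es (((a , q′) ∷ W′ , (a , q) ∷ W) ∷ ws)
    excessʳ (κ , hs , s ∷ ss) with excessˡ (κ , hs , sym s ∷ ss)
    ... | κ′ , hs′ , s′ ∷ ss′ = κ′ , hs′ , sym s′ ∷ ss′

  -- Unification of words of powers from the left. Every branch shortens the word equations and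
  -- moves what was learnt about exponents into the linear system `es`; the number of unknowns may
  -- grow, but the recursion is on `size` only.
  system? : ∀ k {m} (es : List (Equation m)) (ws : List (PEquation m)) → size ws ≤ k → Dec (Solvable es ws)
  system? k es [] _ = map′ (λ (κ , hs) → κ , hs , []) (λ (κ , hs , _) → κ , hs) (linear? es)
  system? (suc k) es (([] , []) ∷ ws) (s≤s l) =
    map′ (λ (κ , hs , ss) → κ , hs , refl ∷ ss) (λ { (κ , hs , _ ∷ ss) → κ , hs , ss }) (system? k es ws l)
  system? (suc k) es (([] , (b , q) ∷ W) ∷ ws) (s≤s l) =
    map′ (λ { (κ , h ∷ hs , s ∷ ss) → κ , hs , subst id (sym (dropʳ {κ = κ} {b} q {W} h)) s ∷ ss })
         (λ { (κ , hs , s ∷ ss) → let z = zero-value κ s in κ , z ∷ hs , subst id (dropʳ {κ = κ} {b} q {W} z) s ∷ ss })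
         (system? k (IsZero q ∷ es) (([] , W) ∷ ws) l)
    where
    zero-value : ∀ κ → [] ≡ spell κ ((b , q) ∷ W) → value κ q ≡ 0
    zero-value κ s with value κ q
    ... | zero = refl
  system? (suc k) es (((a , q) ∷ W , []) ∷ ws) (s≤s l) =
    map′ (λ { (κ , h ∷ hs , s ∷ ss) → κ , hs , subst id (sym (dropˡ {κ = κ} {a} q {W} h)) s ∷ ss })
         (λ { (κ , hs , s ∷ ss) → let z = zero-value κ s in κ , z ∷ hs , subst id (dropˡ {κ = κ} {a} q {W} z) s ∷ ss })
         (system? k (IsZero q ∷ es) ((W , []) ∷ ws) l)
    where
    zero-value : ∀ κ → spell κ ((a , q) ∷ W) ≡ [] → value κ q ≡ 0
    zero-value κ s with value κ q
    ... | zero = refl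
  system? (suc k) es (((a , q) ∷ W , (b , q′) ∷ W′) ∷ ws) (s≤s l) with a ≟ b
  -- Two distinct letters cannot both begin the same word, so one of the two powers is empty.
  ... | no a≢b = map′ from to
    (system? k (IsZero q ∷ es) ((W , (b , q′) ∷ W′) ∷ ws) l ⊎-dec
     system? k (IsZero q′ ∷ es) (((a , q) ∷ W , W′) ∷ ws) (subst (_≤ k) (cong (λ i → suc (i + size ws)) (+-suc (length W) (length W′))) l))
    where
    from : _ ⊎ _ → Solvable es _
    from (inj₁ (κ , h ∷ hs , s ∷ ss)) = κ , hs , subst id (sym (dropˡ {κ = κ} {a} q {W} h)) s ∷ ss
    from (inj₂ (κ , h ∷ hs , s ∷ ss)) = κ , hs , subst id (sym (dropʳ {κ = κ} {b} q′ {W′} h)) s ∷ ss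
    to : Solvable es _ → _ ⊎ _
    to (κ , hs , s ∷ ss) with replicate-head a≢b (value κ q) (value κ q′) s
    ... | inj₁ z = inj₁ (κ , z ∷ hs , subst id (dropˡ {κ = κ} {a} q {W} z) s ∷ ss)
    ... | inj₂ z = inj₂ (κ , z ∷ hs , subst id (dropʳ {κ = κ} {b} q′ {W′} z) s ∷ ss)
  -- It is unknown which power is longer, so both orders are tried; in each, the shorter power is
  -- cancelled and the excess of the longer one stays in front.
  ... | yes refl = map′ [ L.excessˡ , R.excessʳ ]′ to
    (system? k L.es⁺ ((L.rest , liftWord W′) ∷ map liftPEq ws) (≤-trans (≤-reflexive (begin
        suc (suc (length (liftWord W) + length (liftWord W′) + size (map liftPEq ws)))
          ≡⟨ cong₂ (λ i j → suc (suc (i + j + size (map liftPEq ws)))) (length-map _ W) (length-map _ W′) ⟩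
        suc (suc (length W + length W′ + size (map liftPEq ws)))
          ≡⟨ cong₂ (λ i j → suc (i + j)) (sym (+-suc (length W) (length W′))) (size-lift ws) ⟩
        suc (length W + suc (length W′) + size ws) ∎)) l) ⊎-dec
     system? k R.es⁺ ((liftWord W , R.rest) ∷ map liftPEq ws) (≤-trans (≤-reflexive (
          cong suc (cong₂ _+_ (cong₂ (λ i j → i + suc j) (length-map _ W) (length-map _ W′)) (size-lift ws)))) l))
    where
    open ≡-Reasoning
    module L = Excess a q q′ W W′ es ws
    module R = Excess a q′ q W′ W es ws
    to : Solvable es _ → _ ⊎ _
    to (κ , hs , s ∷ ss) with ≤-total (value κ q′) (value κ q)
    ... | inj₁ le = let o , eq = m≤n⇒∃[o]m+o≡n le in
      inj₁ (L.κ⁺ {κ} eq , L.es⁺-holds {κ} eq hs , L.cancel {κ} eq s ∷ L.ws⁺-spell {κ} eq ss)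
    ... | inj₂ le = let o , eq = m≤n⇒∃[o]m+o≡n le in
      inj₂ (R.κ⁺ {κ} eq , R.es⁺-holds {κ} eq hs , sym (R.cancel {κ} eq (sym s)) ∷ R.ws⁺-spell {κ} eq ss)

  parametric? : ∀ {m} (ws : List (PEquation m)) → Dec (∃ λ (κ : Fin m → ℕ) → All (Spells κ) ws)
  parametric? ws = map′ (λ (κ , _ , ss) → κ , ss) (λ (κ , ss) → κ , [] , ss) (system? (size ws) [] ws ≤-refl)

-- Substitutions and factorizations

apply : {A V : Set} → (V → List A) → List (A ⊎ V) → List A
apply S [] = []
apply S (inj₁ a ∷ U) = a ∷ apply S U
apply S (inj₂ x ∷ U) = S x ++ apply S U

expand : {A B V : Set} → (B → List A) → List (B ⊎ V) → List (A ⊎ V)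
expand h [] = []
expand h (inj₁ b ∷ U) = map inj₁ (h b) ++ expand h U
expand h (inj₂ x ∷ U) = inj₂ x ∷ expand h U

vars : {A V : Set} → List (A ⊎ V) → ℕ
vars [] = 0
vars (inj₁ a ∷ U) = vars U
vars (inj₂ x ∷ U) = suc (vars U)

-- (u , nothing) stands for the substitution X ↦ u, and (u , just v) for X ↦ u X v.
Pop : Set → Set
Pop A = List A × Maybe (List A)

popped : {A V : Set} → Pop A → V → List (A ⊎ V) → List (A ⊎ V)
popped (u , nothing) x W = map inj₁ u ++ W
popped (u , just v)  x W = map inj₁ u ++ inj₂ x ∷ map inj₁ v ++ W

popAll : {A V : Set} → (V → Pop A) → List (A ⊎ V) → List (A ⊎ V)
popAll π [] = []
popAll π (inj₁ a ∷ U) = inj₁ a ∷ popAll π U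
popAll π (inj₂ x ∷ U) = popped (π x) x (popAll π U)

refill : {A : Set} → Pop A → List A → List A
refill (u , nothing) t = u
refill (u , just v)  t = u ++ t ++ v

module _ {A V : Set} where

  apply-inj₁ : (S : V → List A) (w : List A) (U : List (A ⊎ V)) → apply S (map inj₁ w ++ U) ≡ w ++ apply S U
  apply-inj₁ S [] U = refl
  apply-inj₁ S (a ∷ w) U = cong (a ∷_) (apply-inj₁ S w U)

  apply-++ : (S : V → List A) (U W : List (A ⊎ V)) → apply S (U ++ W) ≡ apply S U ++ apply S W
  apply-++ S [] W = refl
  apply-++ S (inj₁ a ∷ U) W = cong (a ∷_) (apply-++ S U W)
  apply-++ S (inj₂ x ∷ U) W = trans (cong (S x ++_) (apply-++ S U W)) (sym (++-assoc (S x) _ _))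

  apply-cong : {S S′ : V → List A} → (∀ x → S x ≡ S′ x) → ∀ U → apply S U ≡ apply S′ U
  apply-cong eq [] = refl
  apply-cong eq (inj₁ a ∷ U) = cong (a ∷_) (apply-cong eq U)
  apply-cong eq (inj₂ x ∷ U) = cong₂ _++_ (eq x) (apply-cong eq U)

  popAll-cong : {π π′ : V → Pop A} → (∀ x → π x ≡ π′ x) → ∀ U → popAll π U ≡ popAll π′ U
  popAll-cong eq [] = refl
  popAll-cong eq (inj₁ a ∷ U) = cong (inj₁ a ∷_) (popAll-cong eq U)
  popAll-cong eq (inj₂ x ∷ U) = cong₂ (λ p W → popped p x W) (eq x) (popAll-cong eq U)

  apply-popAll : (π : V → Pop A) (S : V → List A) (U : List (A ⊎ V)) →
    apply S (popAll π U) ≡ apply (λ x → refill (π x) (S x)) U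
  apply-popAll π S [] = refl
  apply-popAll π S (inj₁ a ∷ U) = cong (a ∷_) (apply-popAll π S U)
  apply-popAll π S (inj₂ x ∷ U) with π x
  ... | u , nothing = trans (apply-inj₁ S u _) (cong (u ++_) (apply-popAll π S U))
  ... | u , just v = begin
    apply S (map inj₁ u ++ inj₂ x ∷ map inj₁ v ++ popAll π U) ≡⟨ apply-inj₁ S u _ ⟩
    u ++ S x ++ apply S (map inj₁ v ++ popAll π U)            ≡⟨ cong (λ w → u ++ S x ++ w) (apply-inj₁ S v _) ⟩
    u ++ S x ++ v ++ apply S (popAll π U)                     ≡⟨ cong (λ w → u ++ S x ++ v ++ w) (apply-popAll π S U) ⟩
    u ++ S x ++ v ++ R                                        ≡⟨ cong (u ++_) (sym (++-assoc (S x) v R)) ⟩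
    u ++ (S x ++ v) ++ R                                      ≡⟨ sym (++-assoc u (S x ++ v) R) ⟩
    (u ++ S x ++ v) ++ R                                      ∎
    where
    open ≡-Reasoning
    R : List A
    R = apply (λ x → refill (π x) (S x)) U

apply-expand : {A B V : Set} (h : B → List A) (S : V → List B) (U : List (B ⊎ V)) →
  apply (concatMap h ∘′ S) (expand h U) ≡ concatMap h (apply S U)
apply-expand h S [] = refl
apply-expand h S (inj₁ b ∷ U) = trans (apply-inj₁ _ (h b) _) (cong (h b ++_) (apply-expand h S U))
apply-expand h S (inj₂ x ∷ U) = trans (cong (concatMap h (S x) ++_) (apply-expand h S U))
  (trans (concat-++ (map h (S x)) _) (cong concat (sym (map-++ h (S x) _))))

expand-cong : {A B V : Set} {g h : B → List A} → (∀ b → g b ≡ h b) → (U : List (B ⊎ V)) → expand g U ≡ expand h U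
expand-cong eq [] = refl
expand-cong eq (inj₁ b ∷ U) = cong₂ (λ w W → map inj₁ w ++ W) (eq b) (expand-cong eq U)
expand-cong eq (inj₂ x ∷ U) = cong (inj₂ x ∷_) (expand-cong eq U)

names : {A V : Set} → List (A ⊎ V) → List A
names [] = []
names (inj₁ a ∷ U) = a ∷ names U
names (inj₂ x ∷ U) = names U

length-names : {A V : Set} (U : List (A ⊎ V)) → length (names U) ≤ length U
length-names [] = z≤n
length-names (inj₁ a ∷ U) = s≤s (length-names U)
length-names (inj₂ x ∷ U) = m≤n⇒m≤1+n (length-names U)

-- Renaming with erasure is a homomorphism, so it carries solutions to solutions. Letters that occur
-- in the solution but not in the equation can thus be dropped instead of named.
relabel : {A B V : Set} → (A → Maybe B) → List (A ⊎ V) → List (B ⊎ V)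
relabel ρ [] = []
relabel ρ (inj₁ a ∷ U) with ρ a
... | just b = inj₁ b ∷ relabel ρ U
... | nothing = relabel ρ U
relabel ρ (inj₂ x ∷ U) = inj₂ x ∷ relabel ρ U

module _ {A B V : Set} (ρ : A → Maybe B) where

  apply-relabel : (S : V → List A) (U : List (A ⊎ V)) →
    apply (mapMaybe ρ ∘′ S) (relabel ρ U) ≡ mapMaybe ρ (apply S U)
  apply-relabel S [] = refl
  apply-relabel S (inj₁ a ∷ U) with ρ a
  ... | just b = cong (b ∷_) (apply-relabel S U)
  ... | nothing = apply-relabel S U
  apply-relabel S (inj₂ x ∷ U) = trans (cong (mapMaybe ρ (S x) ++_) (apply-relabel S U))
    (sym (mapMaybe-++ ρ (S x) (apply S U)))

  length-relabel : (U : List (A ⊎ V)) → length (relabel ρ U) ≤ length U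
  length-relabel [] = z≤n
  length-relabel (inj₁ a ∷ U) with ρ a
  ... | just b = s≤s (length-relabel U)
  ... | nothing = m≤n⇒m≤1+n (length-relabel U)
  length-relabel (inj₂ x ∷ U) = s≤s (length-relabel U)

  vars-relabel : (U : List (A ⊎ V)) → vars (relabel ρ U) ≡ vars U
  vars-relabel [] = refl
  vars-relabel (inj₁ a ∷ U) with ρ a
  ... | just b = vars-relabel U
  ... | nothing = vars-relabel U
  vars-relabel (inj₂ x ∷ U) = cong suc (vars-relabel U)

  expand-relabel : {C : Set} (h : B → A) (g : A → List C) (U : List (A ⊎ V)) →
    (∀ {a} → a ∈ names U → ∃ λ b → ρ a ≡ just b × h b ≡ a) → expand (g ∘′ h) (relabel ρ U) ≡ expand g U
  expand-relabel h g [] _ = refl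
  expand-relabel h g (inj₁ a ∷ U) p with ρ a | p (here refl)
  ... | _ | b , refl , refl = cong (map inj₁ (g (h b)) ++_) (expand-relabel h g U (p ∘′ there))
  expand-relabel h g (inj₂ x ∷ U) p = cong (inj₂ x ∷_) (expand-relabel h g U p)

-- Names for the elements of `L`, given by their position. Names left over decode to the default
-- `b₀`, so that `P` holds for the meaning of every name.
naming : {B : Set} → DecidableEquality B → {P : B → Set} {b₀ : B} → P b₀ →
  ∀ {L} → All P L → ∀ K → length L ≤ K →
  ∃₂ λ (ρ : B → Maybe (Fin K)) (h : Fin K → B) →
    (∀ {b} → b ∈ L → ∃ λ c → ρ b ≡ just c × h c ≡ b) × (∀ c → P (h c))
naming _≟_ {b₀ = b₀} p₀ [] K _ = (λ _ → nothing) , (λ _ → b₀) , (λ ()) , λ _ → p₀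
naming {B} _≟_ {P} p₀ {b ∷ L} (p ∷ ps) (suc K) (s≤s le) with naming _≟_ p₀ ps K le
... | ρ , h , inv , ph = ρ′ , h′ , inv′ , λ { zero → p ; (suc c) → ph c }
  where
  ρ′ : B → Maybe (Fin (suc K))
  ρ′ x with x ≟ b
  ... | yes _ = just zero
  ... | no _ = Maybe.map suc (ρ x)
  h′ : Fin (suc K) → B
  h′ zero = b
  h′ (suc c) = h c
  inv′ : ∀ {x} → x ∈ b ∷ L → ∃ λ c → ρ′ x ≡ just c × h′ c ≡ x
  inv′ {x} x∈ with x ≟ b | x∈
  ... | yes x≡b | _ = zero , refl , sym x≡b
  ... | no x≢b | here x≡b = contradiction x≡b x≢b
  ... | no _ | there x∈L = let c , eq , hc = inv x∈L in suc c , cong (Maybe.map suc) eq , hc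

-- Factorizations determined by pairs of consecutive letters

Factor : Set → Set
Factor A = A × List A

letters : {A : Set} → Factor A → List A
letters (a , f) = a ∷ f

count : {A : Set} → (A → A → Bool) → List (A × A) → ℕ
count J [] = 0
count J ((a , b) ∷ ps) = bit (J a b) + count J ps

adjacent : {A V : Set} → List (A ⊎ V) → List (A × A)
adjacent [] = []
adjacent (inj₁ a ∷ []) = []
adjacent (inj₁ a ∷ inj₁ b ∷ U) = (a , b) ∷ adjacent (inj₁ b ∷ U)
adjacent (inj₁ a ∷ inj₂ x ∷ U) = adjacent (inj₂ x ∷ U)
adjacent (inj₂ x ∷ U) = adjacent U

mutual

  -- A letter begins an adjacent pair unless a variable or the end follows. So there are at most
  -- `vars U + 1` letters beyond the pairs, and the variables themselves account for the second
  -- `vars U`.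
  length-adjacent : {A V : Set} (U : List (A ⊎ V)) → length U ≤ suc (length (adjacent U) + (vars U + vars U))
  length-adjacent [] = z≤n
  length-adjacent (inj₁ a ∷ []) = ≤-refl
  length-adjacent (inj₁ a ∷ inj₁ b ∷ U) = s≤s (length-adjacent (inj₁ b ∷ U))
  length-adjacent (inj₁ a ∷ inj₂ x ∷ U) = s≤s (length-adjacent-var x U)
  length-adjacent (inj₂ x ∷ U) = m≤n⇒m≤1+n (length-adjacent-var x U)

  length-adjacent-var : {A V : Set} (x : V) (U : List (A ⊎ V)) →
    suc (length U) ≤ length (adjacent U) + (suc (vars U) + suc (vars U))
  length-adjacent-var x U = ≤-trans (s≤s (length-adjacent U)) (≤-reflexive
    (solve 2 (λ l v → con 2 :+ (l :+ (v :+ v)) := l :+ ((con 1 :+ v) :+ (con 1 :+ v))) refl (length (adjacent U)) (vars U)))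
    where open +-*-Solver

module Factorization {A V : Set} (J : A → A → Bool) where

  glue : A → List (Factor A) → List (Factor A)
  glue a [] = (a , []) ∷ []
  glue a ((b , f) ∷ F) = if J a b then (a , b ∷ f) ∷ F else (a , []) ∷ (b , f) ∷ F

  factors : List A → List (Factor A)
  factors = foldr glue []

  glueV : A ⊎ V → List (Factor A ⊎ V) → List (Factor A ⊎ V)
  glueV (inj₂ x) Z = inj₂ x ∷ Z
  glueV (inj₁ a) (inj₁ (b , f) ∷ Z) = if J a b then inj₁ (a , b ∷ f) ∷ Z else inj₁ (a , []) ∷ inj₁ (b , f) ∷ Z
  glueV (inj₁ a) Z = inj₁ (a , []) ∷ Z

  factorsV : List (A ⊎ V) → List (Factor A ⊎ V)
  factorsV = foldr glueV []

  -- A variable survives only if its value has at least two factors; otherwise the whole value is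
  -- popped. A surviving variable therefore always stands between two complete factors.
  data Peel : List (Factor A) → Pop A → List (Factor A) → Set where
    none : Peel [] ([] , nothing) []
    one  : ∀ f → Peel (f ∷ []) (letters f , nothing) []
    many : ∀ f mid g → Peel (f ∷ mid ++ [ g ]) (letters f , just (letters g)) mid

  unsnoc : ∀ (f : Factor A) F → ∃₂ λ mid g → f ∷ F ≡ mid ++ [ g ]
  unsnoc f [] = [] , f , refl
  unsnoc f (f′ ∷ F) = let mid , g , eq = unsnoc f′ F in f ∷ mid , g , cong (f ∷_) eq

  peel : ∀ F → ∃₂ (Peel F)
  peel [] = _ , _ , none
  peel (f ∷ []) = _ , _ , one f
  peel (f ∷ f′ ∷ F) with unsnoc f′ F
  ... | mid , g , eq rewrite eq = _ , _ , many f mid g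

  Joined : List A → Set
  Joined = Linked λ a b → T (J a b)

  glue-joined : ∀ a F → All (Joined ∘′ letters) F → All (Joined ∘′ letters) (glue a F)
  glue-joined a [] [] = [-] ∷ []
  glue-joined a ((b , f) ∷ F) (j ∷ js) with J a b in eq
  ... | true = (subst T (sym eq) tt ∷ j) ∷ js
  ... | false = [-] ∷ j ∷ js

  factors-joined : ∀ w → All (Joined ∘′ letters) (factors w)
  factors-joined [] = []
  factors-joined (a ∷ w) = glue-joined a (factors w) (factors-joined w)

  glueV-joined : ∀ a Z → All (Joined ∘′ letters) (names Z) → All (Joined ∘′ letters) (names (glueV (inj₁ a) Z))
  glueV-joined a [] js = [-] ∷ js
  glueV-joined a (inj₂ x ∷ Z) js = [-] ∷ js
  glueV-joined a (inj₁ (b , f) ∷ Z) (j ∷ js) with J a b in eq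
  ... | true = (subst T (sym eq) tt ∷ j) ∷ js
  ... | false = [-] ∷ j ∷ js

  factorsV-joined : ∀ W → All (Joined ∘′ letters) (names (factorsV W))
  factorsV-joined [] = []
  factorsV-joined (inj₁ a ∷ W) = glueV-joined a (factorsV W) (factorsV-joined W)
  factorsV-joined (inj₂ x ∷ W) = factorsV-joined W

  expand-glueV : ∀ s Z → expand letters (glueV s Z) ≡ s ∷ expand letters Z
  expand-glueV (inj₂ x) Z = refl
  expand-glueV (inj₁ a) [] = refl
  expand-glueV (inj₁ a) (inj₂ x ∷ Z) = refl
  expand-glueV (inj₁ a) (inj₁ (b , f) ∷ Z) with J a b
  ... | true = refl
  ... | false = refl

  expand-factorsV : ∀ W → expand letters (factorsV W) ≡ W
  expand-factorsV [] = refl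
  expand-factorsV (s ∷ W) = trans (expand-glueV s (factorsV W)) (cong (s ∷_) (expand-factorsV W))

  vars-glueV : ∀ a Z → vars (glueV (inj₁ a) Z) ≡ vars Z
  vars-glueV a [] = refl
  vars-glueV a (inj₂ x ∷ Z) = refl
  vars-glueV a (inj₁ (b , f) ∷ Z) with J a b
  ... | true = refl
  ... | false = refl

  vars-factorsV : ∀ W → vars (factorsV W) ≡ vars W
  vars-factorsV [] = refl
  vars-factorsV (inj₁ a ∷ W) = trans (vars-glueV a (factorsV W)) (vars-factorsV W)
  vars-factorsV (inj₂ x ∷ W) = cong suc (vars-factorsV W)

  -- The factorization of a concatenation from those of its parts. Whether there is a cut at the
  -- seam depends on the two letters meeting there, so only the last factor on the left is glued
  -- anew.
  _▹_ : List (Factor A) → List (Factor A) → List (Factor A)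
  [] ▹ Q = Q
  (f ∷ []) ▹ Q = foldr glue Q (letters f)
  (f ∷ f′ ∷ F) ▹ Q = f ∷ ((f′ ∷ F) ▹ Q)

  snoc-▹ : ∀ F g Q → (F ++ [ g ]) ▹ Q ≡ F ++ foldr glue Q (letters g)
  snoc-▹ [] g Q = refl
  snoc-▹ (f ∷ []) g Q = refl
  snoc-▹ (f ∷ f′ ∷ F) g Q = cong (f ∷_) (snoc-▹ (f′ ∷ F) g Q)

  glue-head : ∀ b Q → ∃₂ λ f F → glue b Q ≡ (b , f) ∷ F
  glue-head b [] = _ , _ , refl
  glue-head b ((c , f) ∷ F) with J b c
  ... | true = _ , _ , refl
  ... | false = _ , _ , refl

  glue-split : ∀ {a b} → J a b ≡ false → ∀ Q → glue a (glue b Q) ≡ (a , []) ∷ glue b Q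
  glue-split {a} {b} eq Q with glue b Q | glue-head b Q
  ... | _ | _ , _ , refl rewrite eq = refl

  glue-▹ : ∀ a P Q → glue a (P ▹ Q) ≡ glue a P ▹ Q
  glue-▹ a [] Q = refl
  glue-▹ a ((b , f) ∷ []) Q with J a b in eq
  ... | true = refl
  ... | false = glue-split eq (foldr glue Q f)
  glue-▹ a ((b , f) ∷ f′ ∷ F) Q with J a b
  ... | true = refl
  ... | false = refl

  foldr-glue : ∀ w Q → foldr glue Q w ≡ factors w ▹ Q
  foldr-glue [] Q = refl
  foldr-glue (a ∷ w) Q = trans (cong (glue a) (foldr-glue w Q)) (glue-▹ a (factors w) Q)

  factors-++ : ∀ w w′ → factors (w ++ w′) ≡ factors w ▹ factors w′
  factors-++ w w′ = trans (foldr-++ glue [] w w′) (foldr-glue w (factors w′))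

  -- The words that do not begin with a variable. `glueV` cuts before every variable, so
  -- substitution commutes with gluing a letter only in front of such a word.
  data Solid : List (Factor A ⊎ V) → Set where
    empty  : Solid []
    letter : ∀ f Z → Solid (inj₁ f ∷ Z)

  glueV-solid : ∀ a Z → Solid (glueV (inj₁ a) Z)
  glueV-solid a [] = letter _ _
  glueV-solid a (inj₂ x ∷ Z) = letter _ _
  glueV-solid a (inj₁ (b , f) ∷ Z) with J a b
  ... | true = letter _ _
  ... | false = letter _ _

  glueV-word : List (Factor A ⊎ V) → List A → List (Factor A ⊎ V)
  glueV-word Z w = foldr glueV Z (map inj₁ w)

  factorsV-++ : ∀ w W → factorsV (map inj₁ w ++ W) ≡ glueV-word (factorsV W) w
  factorsV-++ w W = foldr-++ glueV [] (map inj₁ w) W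

  module _ (S : V → List (Factor A)) where

    apply-glueV : ∀ a {Z} → Solid Z → apply S (glueV (inj₁ a) Z) ≡ glue a (apply S Z)
    apply-glueV a empty = refl
    apply-glueV a (letter (b , f) Z) with J a b
    ... | true = refl
    ... | false = refl

    apply-glueV-word : ∀ w {Z} → Solid Z → Solid (glueV-word Z w) × apply S (glueV-word Z w) ≡ foldr glue (apply S Z) w
    apply-glueV-word [] s = s , refl
    apply-glueV-word (a ∷ w) {Z} s = let s′ , eq = apply-glueV-word w s in
      glueV-solid a (glueV-word Z w) , trans (apply-glueV a s′) (cong (glue a) eq)

  glueV-letters : ∀ {f} → Joined (letters f) → ∀ x Z → glueV-word (inj₂ x ∷ Z) (letters f) ≡ inj₁ f ∷ inj₂ x ∷ Z
  glueV-letters {a , []} [-] x Z = refl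
  glueV-letters {a , b ∷ f} (j ∷ js) x Z rewrite glueV-letters {b , f} js x Z with J a b
  ... | true = refl

  glueV-head : ∀ b Z → ∃₂ λ f Z′ → glueV (inj₁ b) Z ≡ inj₁ (b , f) ∷ Z′
  glueV-head b [] = _ , _ , refl
  glueV-head b (inj₂ x ∷ Z) = _ , _ , refl
  glueV-head b (inj₁ (c , f) ∷ Z) with J b c
  ... | true = _ , _ , refl
  ... | false = _ , _ , refl

  length-glueV : ∀ a b Z → length (glueV (inj₁ a) (glueV (inj₁ b) Z)) + bit (J a b) ≡ suc (length (glueV (inj₁ b) Z))
  length-glueV a b Z with glueV (inj₁ b) Z | glueV-head b Z
  ... | _ | _ , Z′ , refl with J a b
  ... | true = +-comm (suc (length Z′)) 1
  ... | false = +-identityʳ _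

  length-glueV≤ : ∀ a Z → length (glueV (inj₁ a) Z) ≤ suc (length Z)
  length-glueV≤ a [] = ≤-refl
  length-glueV≤ a (inj₂ x ∷ Z) = ≤-refl
  length-glueV≤ a (inj₁ (b , f) ∷ Z) with J a b
  ... | true = n≤1+n _
  ... | false = ≤-refl

  length-glueV-letters : ∀ {f} → Joined (letters f) → ∀ Z → length (glueV-word Z (letters f)) ≤ suc (length Z)
  length-glueV-letters {a , []} [-] Z = length-glueV≤ a Z
  length-glueV-letters {a , b ∷ f} (j ∷ js) Z
    with J a b | length-glueV a b (glueV-word Z f) | length-glueV-letters {b , f} js Z
  ... | true | eq | ih = ≤-trans (≤-reflexive (suc-injective (trans (+-comm 1 _) eq))) ih

  length-factorsV : ∀ U → length (factorsV U) + count J (adjacent U) ≡ length U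
  length-factorsV [] = refl
  length-factorsV (inj₁ a ∷ []) = refl
  length-factorsV (inj₁ a ∷ inj₁ b ∷ U) = begin
    length (factorsV (inj₁ a ∷ inj₁ b ∷ U)) + (bit (J a b) + c) ≡⟨ sym (+-assoc _ (bit (J a b)) c) ⟩
    length (factorsV (inj₁ a ∷ inj₁ b ∷ U)) + bit (J a b) + c   ≡⟨ cong (_+ c) (length-glueV a b (factorsV U)) ⟩
    suc (length (factorsV (inj₁ b ∷ U)) + c)                    ≡⟨ cong suc (length-factorsV (inj₁ b ∷ U)) ⟩
    suc (length (inj₁ b ∷ U))                                   ∎
    where
    open ≡-Reasoning
    c : ℕ
    c = count J (adjacent (inj₁ b ∷ U))
  length-factorsV (inj₁ a ∷ inj₂ x ∷ U) = cong suc (length-factorsV (inj₂ x ∷ U))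
  length-factorsV (inj₂ x ∷ U) = cong suc (length-factorsV U)

  vars-inj₁ : ∀ w (W : List (A ⊎ V)) → vars (map inj₁ w ++ W) ≡ vars W
  vars-inj₁ [] W = refl
  vars-inj₁ (a ∷ w) W = vars-inj₁ w W

  module _ (S : V → List A) {π : V → Pop A} {mid : V → List (Factor A)}
    (peeled : ∀ x → Peel (factors (S x)) (π x) (mid x)) where

    -- Locality of the cuts: after popping, both ends of the value left in a variable are cuts of
    -- `apply S U`. Hence factorizing the equation and factorizing its solution agree, with `mid` as
    -- the new substitution.
    apply-factorsV : ∀ U → Solid (factorsV (popAll π U)) ×
      apply mid (factorsV (popAll π U)) ≡ factors (apply S U)
    apply-factorsV [] = empty , refl
    apply-factorsV (inj₁ a ∷ U) = let s , eq = apply-factorsV U in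
      glueV-solid a (factorsV (popAll π U)) , trans (apply-glueV mid a s) (cong (glue a) eq)
    apply-factorsV (inj₂ x ∷ U) rewrite factors-++ (S x) (apply S U)
      with factors (S x) | π x | mid x in eq | peeled x | factors-joined (S x) | apply-factorsV U
    ... | _ | _ | _ | none | _ | ih = ih
    ... | _ | _ | _ | one f | _ | s , ih
      rewrite factorsV-++ (letters f) (popAll π U) = let s′ , eq′ = apply-glueV-word mid (letters f) s in
        s′ , trans eq′ (cong (λ Q → foldr glue Q (letters f)) ih)
    -- The first factor `f` stands directly before the variable and becomes one letter by
    -- `glueV-letters`; the last factor `g` may still merge with what follows.
    ... | _ | _ | _ | many f m g | j ∷ _ | s , ih
      rewrite factorsV-++ (letters f) (inj₂ x ∷ map inj₁ (letters g) ++ popAll π U)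
            | factorsV-++ (letters g) (popAll π U)
            | glueV-letters {f} j x (glueV-word (factorsV (popAll π U)) (letters g)) = letter _ _ , (begin
        f ∷ mid x ++ apply mid (glueV-word (factorsV (popAll π U)) (letters g))
          ≡⟨ cong₂ (λ m Q → f ∷ m ++ Q) eq (proj₂ (apply-glueV-word mid (letters g) s)) ⟩
        f ∷ m ++ foldr glue (apply mid (factorsV (popAll π U))) (letters g)
          ≡⟨ cong (λ Q → f ∷ m ++ foldr glue Q (letters g)) ih ⟩
        (f ∷ m) ++ foldr glue (factors (apply S U)) (letters g)
          ≡⟨ sym (snoc-▹ (f ∷ m) g (factors (apply S U))) ⟩
        (f ∷ m ++ [ g ]) ▹ factors (apply S U) ∎)
      where open ≡-Reasoning

    vars-popAll : ∀ U → vars (popAll π U) ≤ vars U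
    vars-popAll [] = z≤n
    vars-popAll (inj₁ a ∷ U) = vars-popAll U
    vars-popAll (inj₂ x ∷ U) with π x
    ... | u , nothing rewrite vars-inj₁ u (popAll π U) = m≤n⇒m≤1+n (vars-popAll U)
    ... | u , just v rewrite vars-inj₁ u (inj₂ x ∷ map inj₁ v ++ popAll π U) | vars-inj₁ v (popAll π U) = s≤s (vars-popAll U)

    -- Each popped word is a single factor, so a variable brings in at most two new letters. Gluing
    -- between two explicit letters is the same before and after popping, hence the cancellation of
    -- `j`.
    length-factorsV-popAll : ∀ U → length (factorsV (popAll π U)) ≤ length (factorsV U) + (vars U + vars U)
    length-factorsV-popAll [] = z≤n
    length-factorsV-popAll (inj₁ a ∷ []) = ≤-refl
    length-factorsV-popAll (inj₁ a ∷ inj₁ b ∷ U) = +-cancelʳ-≤ j _ _ (begin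
      length (glueV (inj₁ a) (glueV (inj₁ b) Z′)) + j ≡⟨ length-glueV a b Z′ ⟩
      suc (length (glueV (inj₁ b) Z′))                ≤⟨ s≤s (length-factorsV-popAll (inj₁ b ∷ U)) ⟩
      suc (length (glueV (inj₁ b) Z)) + v             ≡⟨ cong (_+ v) (sym (length-glueV a b Z)) ⟩
      l + j + v                                       ≡⟨ solve 3 (λ l j v → l :+ j :+ v := l :+ v :+ j) refl l j v ⟩
      l + v + j                                       ∎)
      where
      open ≤-Reasoning
      open +-*-Solver
      Z Z′ : List (Factor A ⊎ V)
      Z = factorsV U
      Z′ = factorsV (popAll π U)
      j l v : ℕ
      j = bit (J a b)
      l = length (glueV (inj₁ a) (glueV (inj₁ b) Z))
      v = vars U + vars U
    length-factorsV-popAll (inj₁ a ∷ inj₂ x ∷ U) =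
      ≤-trans (length-glueV≤ a (factorsV (popAll π (inj₂ x ∷ U)))) (s≤s (length-factorsV-popAll (inj₂ x ∷ U)))
    length-factorsV-popAll (inj₂ x ∷ U) = ≤-trans
      (grow (factors (S x)) (factors-joined (S x)) (peeled x))
      (≤-trans (+-monoʳ-≤ 3 (length-factorsV-popAll U)) (≤-reflexive
        (solve 2 (λ l v → con 3 :+ (l :+ (v :+ v)) := con 1 :+ l :+ ((con 1 :+ v) :+ (con 1 :+ v)))
          refl (length (factorsV U)) (vars U))))
      where
      open +-*-Solver
      W : List (A ⊎ V)
      W = popAll π U
      grow : ∀ F → All (Joined ∘′ letters) F → ∀ {p m} → Peel F p m →
        length (factorsV (popped p x W)) ≤ 3 + length (factorsV W)
      grow _ _ none = m≤n+m _ 3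
      grow _ (j ∷ _) (one f) rewrite factorsV-++ (letters f) W =
        ≤-trans (length-glueV-letters j (factorsV W)) (m≤n+m _ 2)
      grow _ (j ∷ js) (many f m g)
        rewrite factorsV-++ (letters f) (inj₂ x ∷ map inj₁ (letters g) ++ W) | factorsV-++ (letters g) W =
        ≤-trans (length-glueV-letters j _) (+-monoʳ-≤ 2 (length-glueV-letters (All.head (++⁻ʳ m js)) (factorsV W)))

  length-glue≤ : ∀ a F → length (glue a F) ≤ suc (length F)
  length-glue≤ a [] = ≤-refl
  length-glue≤ a ((b , f) ∷ F) with J a b
  ... | true = n≤1+n _
  ... | false = ≤-refl

  length-factors≤ : ∀ w → length (factors w) ≤ length w
  length-factors≤ [] = z≤n
  length-factors≤ (a ∷ w) = ≤-trans (length-glue≤ a (factors w)) (s≤s (length-factors≤ w))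

  length-factors< : ∀ {a b} → J a b ≡ true → ∀ w → length (factors (a ∷ b ∷ w)) < length (a ∷ b ∷ w)
  length-factors< {a} {b} j w with glue b (factors w) | glue-head b (factors w) | length-factors≤ (b ∷ w)
  ... | _ | _ , _ , refl | le rewrite j = s≤s le

  length-foldr-glue≤ : ∀ w F → length (foldr glue F w) ≤ length w + length F
  length-foldr-glue≤ [] F = ≤-refl
  length-foldr-glue≤ (a ∷ w) F = ≤-trans (length-glue≤ a (foldr glue F w)) (s≤s (length-foldr-glue≤ w F))

  -- Letters adjacent in `U` remain adjacent in `apply S U` for every `S`, so one joined pair of the
  -- equation already shortens the solution.
  apply-shrinks : ∀ (S : V → List A) U → 0 < count J (adjacent U) →
    length (factors (apply S U)) < length (apply S U)
  apply-shrinks S (inj₁ a ∷ inj₁ b ∷ U) = step (apply-shrinks S (inj₁ b ∷ U))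
    where
    step : ∀ {c} → (0 < c → length (factors (b ∷ apply S U)) < length (b ∷ apply S U)) →
      0 < bit (J a b) + c → length (factors (a ∷ b ∷ apply S U)) < length (a ∷ b ∷ apply S U)
    step rec pos with J a b in eq
    ... | true = length-factors< eq (apply S U)
    ... | false = s≤s (≤-trans (length-glue≤ a (factors (b ∷ apply S U))) (rec pos))
  apply-shrinks S (inj₁ a ∷ inj₂ x ∷ U) pos =
    s≤s (≤-trans (length-glue≤ a (factors (apply S (inj₂ x ∷ U)))) (apply-shrinks S (inj₂ x ∷ U) pos))
  apply-shrinks S (inj₂ x ∷ U) pos rewrite foldr-++ glue [] (S x) (apply S U) | length-++ (S x) {apply S U} =
    ≤-trans (s≤s (length-foldr-glue≤ (S x) _))
      (≤-trans (≤-reflexive (sym (+-suc (length (S x)) _))) (+-monoʳ-≤ (length (S x)) (apply-shrinks S U pos)))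

-- A labelling of the letters joining a quarter of the given pairs

-- The label `true` marks the left class.
join : ∀ {k} → (Fin k → Bool) → Fin k → Fin k → Bool
join f a b = does (a ≟ᶠ b) || (f a && not (f b))

separates : ∀ {k} → (Fin k → Bool) → Fin k → Fin k → Bool
separates f a b = does (a ≟ᶠ b) || (f a ⊕ᵇ f b)

extendBy : ∀ {k} → Bool → (Fin k → Bool) → Fin (suc k) → Bool
extendBy b f zero = b
extendBy b f (suc a) = f a

old : ∀ {k} → List (Fin (suc k) × Fin (suc k)) → List (Fin k × Fin k)
old [] = []
old ((suc a , suc b) ∷ ps) = (a , b) ∷ old ps
old ((zero , _) ∷ ps) = old ps
old ((suc _ , zero) ∷ ps) = old ps

add-one : ∀ x y {n} l t u → 1 ≤ x + y → n ≤ l + (t + u) → suc n ≤ l + ((x + t) + (y + u))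
add-one x y l t u xy le = ≤-trans (+-mono-≤ xy le) (≤-reflexive
  (solve 5 (λ x y l t u → (x :+ y) :+ (l :+ (t :+ u)) := l :+ ((x :+ t) :+ (y :+ u))) refl x y l t u))
  where open +-*-Solver

-- A pair involving the new vertex is separated by at least one of the two ways to label that vertex.
separates-extend : ∀ {k} (f : Fin k → Bool) ps →
  length ps + (count (separates f) (old ps) + count (separates f) (old ps)) ≤
  length (old ps) + (count (separates (extendBy true f)) ps + count (separates (extendBy false f)) ps)
separates-extend f [] = z≤n
separates-extend f ((suc a , suc b) ∷ ps) with bit (separates f a b)
... | s = ≤-trans (≤-reflexive (solve 3 (λ l s c → con 1 :+ l :+ ((s :+ c) :+ (s :+ c)) := (con 1 :+ (s :+ s)) :+ (l :+ (c :+ c))) refl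
    (length ps) s (count (separates f) (old ps))))
  (≤-trans (+-monoʳ-≤ (1 + (s + s)) (separates-extend f ps)) (≤-reflexive
    (solve 4 (λ l s t u → (con 1 :+ (s :+ s)) :+ (l :+ (t :+ u)) := con 1 :+ l :+ ((s :+ t) :+ (s :+ u))) refl
      (length (old ps)) s (count (separates (extendBy true f)) ps) (count (separates (extendBy false f)) ps))))
  where open +-*-Solver
separates-extend f ((zero , zero) ∷ ps) = add-one 1 1 (length (old ps))
  (count (separates (extendBy true f)) ps) (count (separates (extendBy false f)) ps) (s≤s z≤n) (separates-extend f ps)
separates-extend f ((zero , suc b) ∷ ps) = add-one (bit (true ⊕ᵇ f b)) (bit (false ⊕ᵇ f b)) (length (old ps))
  (count (separates (extendBy true f)) ps) (count (separates (extendBy false f)) ps) (cover (f b)) (separates-extend f ps)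
  where
  cover : ∀ x → 1 ≤ bit (true ⊕ᵇ x) + bit (false ⊕ᵇ x)
  cover true = ≤-refl
  cover false = ≤-refl
separates-extend f ((suc a , zero) ∷ ps) = add-one (bit (f a ⊕ᵇ true)) (bit (f a ⊕ᵇ false)) (length (old ps))
  (count (separates (extendBy true f)) ps) (count (separates (extendBy false f)) ps) (cover (f a)) (separates-extend f ps)
  where
  cover : ∀ x → 1 ≤ bit (x ⊕ᵇ true) + bit (x ⊕ᵇ false)
  cover true = ≤-refl
  cover false = ≤-refl

larger-summand : ∀ {n} i j → n ≤ i + j → n ≤ i + i ⊎ n ≤ j + j
larger-summand i j le with ≤-total i j
... | inj₁ i≤j = inj₂ (≤-trans le (+-monoˡ-≤ j i≤j))
... | inj₂ j≤i = inj₁ (≤-trans le (+-monoʳ-≤ i j≤i))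

-- The greedy maximum cut argument: letters are labelled one at a time, each with the better of its
-- two labels, which separates at least half of the pairs decided at that moment.
separation : ∀ {k} (ps : List (Fin k × Fin k)) →
  ∃ λ f → length ps ≤ count (separates f) ps + count (separates f) ps
separation {zero} [] = (λ ()) , z≤n
separation {zero} ((() , _) ∷ _)
separation {suc k} ps with separation (old ps)
... | f , le with larger-summand (count (separates (extendBy true f)) ps) (count (separates (extendBy false f)) ps)
  (+-cancelˡ-≤ (length (old ps)) _ _ (≤-trans
    (≤-trans (+-monoˡ-≤ (length ps) le) (≤-reflexive (+-comm _ (length ps)))) (separates-extend f ps)))
... | inj₁ le′ = extendBy true f , le′
... | inj₂ le′ = extendBy false f , le′

-- A separated pair of distinct letters has the order (left, right) for `f` or for its complement.
-- The better of the two keeps half of the separated pairs, hence a quarter of all pairs.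
separates≤joins : ∀ {k} (f : Fin k → Bool) ps →
  count (separates f) ps ≤ count (join f) ps + count (join (not ∘′ f)) ps
separates≤joins f [] = z≤n
separates≤joins f ((a , b) ∷ ps) = ≤-trans (+-mono-≤ (pair (does (a ≟ᶠ b)) (f a) (f b)) (separates≤joins f ps))
  (≤-reflexive (solve 4 (λ i j c d → (i :+ j) :+ (c :+ d) := (i :+ c) :+ (j :+ d)) refl
    (bit (join f a b)) (bit (join (not ∘′ f) a b)) (count (join f) ps) (count (join (not ∘′ f)) ps)))
  where
  open +-*-Solver
  pair : ∀ e x y → bit (e || (x ⊕ᵇ y)) ≤ bit (e || (x && not y)) + bit (e || (not x && not (not y)))
  pair true  _     _     = s≤s z≤n
  pair false true  true  = z≤n
  pair false true  false = s≤s z≤n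
  pair false false true  = s≤s z≤n
  pair false false false = z≤n

double-bound : ∀ {l} c → l ≤ c + c → l + l ≤ 4 * c
double-bound c l≤ = ≤-trans (+-mono-≤ l≤ l≤) (≤-reflexive (solve 1 (λ c → (c :+ c) :+ (c :+ c) := con 4 :* c) refl c))
  where open +-*-Solver

good-labelling : ∀ {k} (ps : List (Fin k × Fin k)) → ∃ λ f → length ps ≤ 4 * count (join f) ps
good-labelling ps with separation ps
... | f , le with larger-summand (count (join f) ps) (count (join (not ∘′ f)) ps) (separates≤joins f ps)
... | inj₁ le′ = f , ≤-trans le (double-bound (count (join f) ps) le′)
... | inj₂ le′ = not ∘′ f , ≤-trans le (double-bound (count (join (not ∘′ f)) ps) le′)

-- Word equations

TwoPowers : {A : Set} → List A → Set
TwoPowers {A} w = ∃₂ λ (ab : A × A) (ij : ℕ × ℕ) →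
  w ≡ replicate (proj₁ ij) (proj₁ ab) ++ replicate (proj₂ ij) (proj₂ ab)

module _ {k} (f : Fin k → Bool) where

  joined-right : ∀ {a w} → f a ≡ false → Linked (λ x y → T (join f x y)) (a ∷ w) → ∃ λ i → a ∷ w ≡ replicate i a
  joined-right fa [-] = 1 , refl
  joined-right {a} fa (_∷_ {y = b} j js) with a ≟ᶠ b
  ... | yes refl = let i , eq = joined-right fa js in suc i , cong (a ∷_) eq
  ... | no _ rewrite fa = ⊥-elim j

  -- The only possible change of letter leads from the left class to the right class, and a right
  -- letter can be followed only by itself.
  joined-shape : ∀ {a w} → Linked (λ x y → T (join f x y)) (a ∷ w) →
    ∃₂ λ b (ij : ℕ × ℕ) → a ∷ w ≡ replicate (proj₁ ij) a ++ replicate (proj₂ ij) b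
  joined-shape {a} [-] = a , (1 , 0) , refl
  joined-shape {a} (_∷_ {y = b} j js) with a ≟ᶠ b
  ... | yes refl = let c , (i , l) , eq = joined-shape js in c , (suc i , l) , cong (a ∷_) eq
  ... | no _ with f a | f b in fb
  ...   | true | false = let i , eq = joined-right fb js in b , (1 , i) , cong (a ∷_) eq

  joined-twoPowers : ∀ ((a , w) : Factor (Fin k)) → Linked (λ x y → T (join f x y)) (a ∷ w) → TwoPowers (a ∷ w)
  joined-twoPowers (a , w) j = let b , ij , eq = joined-shape j in (a , b) , ij , eq

-- A compression step is described by 2n popped words and k names of new letters, all of the form aⁱbʲ.
module Slots (n k : ℕ) where

  slots : ℕ
  slots = (n + n) + k

  left right : Fin n → Fin slots
  left x = (x ↑ˡ n) ↑ˡ k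
  right x = (n ↑ʳ x) ↑ˡ k

  name : Fin k → Fin slots
  name c = (n + n) ↑ʳ c

  module _ {X : Set} (l r : Fin n → X) (h : Fin k → X) where

    assemble : Fin slots → X
    assemble s = [ (λ y → [ l , r ]′ (splitAt n y)) , h ]′ (splitAt (n + n) s)

    assemble-left : ∀ x → assemble (left x) ≡ l x
    assemble-left x rewrite splitAt-↑ˡ (n + n) (x ↑ˡ n) k | splitAt-↑ˡ n x n = refl

    assemble-right : ∀ x → assemble (right x) ≡ r x
    assemble-right x rewrite splitAt-↑ˡ (n + n) (n ↑ʳ x) k | splitAt-↑ʳ n n x = refl

    assemble-name : ∀ c → assemble (name c) ≡ h c
    assemble-name c rewrite splitAt-↑ʳ (n + n) k c = refl

    assemble-all : {P : X → Set} → (∀ x → P (l x)) → (∀ x → P (r x)) → (∀ c → P (h c)) → ∀ s → P (assemble s)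
    assemble-all pl pr ph s with splitAt (n + n) s
    ... | inj₂ c = ph c
    ... | inj₁ y with splitAt n y
    ...   | inj₁ x = pl x
    ...   | inj₂ x = pr x

  module _ {A : Set} (_≟_ : DecidableEquality A) where

    -- An edge compares words that still contain variables, so variables count as further letters
    -- here, always with exponent one.
    Sym : Set
    Sym = A ⊎ Fin n

    _≟ˢ_ : DecidableEquality Sym
    _≟ˢ_ = ⊎-≡-dec _≟_ _≟ᶠ_

    open Parametric _≟ˢ_

    Bases : Set
    Bases = Vec (A × A) slots

    slotWord : Bases → (Fin (slots + slots) → ℕ) → Fin slots → List A
    slotWord bs κ s = replicate (κ (s ↑ˡ slots)) (proj₁ (lookup bs s)) ++ replicate (κ (slots ↑ʳ s)) (proj₂ (lookup bs s))

    popOf : Vec Bool n → (Fin slots → List A) → Fin n → Pop A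
    popOf keep w x = w (left x) , (if lookup keep x then just (w (right x)) else nothing)

    slotPowers : Bases → Fin slots → PWord (slots + slots)
    slotPowers bs s = (inj₁ (proj₁ (lookup bs s)) , 0 , [ s ↑ˡ slots ]) ∷ (inj₁ (proj₂ (lookup bs s)) , 0 , [ slots ↑ʳ s ]) ∷ []

    symbol : Sym → Sym × Exponent (slots + slots)
    symbol s = s , 1 , []

    popPowers : Vec Bool n → Bases → List Sym → PWord (slots + slots)
    popPowers keep bs [] = []
    popPowers keep bs (inj₁ a ∷ U) = symbol (inj₁ a) ∷ popPowers keep bs U
    popPowers keep bs (inj₂ x ∷ U) = slotPowers bs (left x) ++
      (if lookup keep x then symbol (inj₂ x) ∷ slotPowers bs (right x) ++ popPowers keep bs U else popPowers keep bs U)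

    expandPowers : Bases → List (Fin k ⊎ Fin n) → PWord (slots + slots)
    expandPowers bs [] = []
    expandPowers bs (inj₁ c ∷ U) = slotPowers bs (name c) ++ expandPowers bs U
    expandPowers bs (inj₂ x ∷ U) = symbol (inj₂ x) ∷ expandPowers bs U

    replicate-inj₁ : ∀ i (a : A) → replicate i (inj₁ {B = Fin n} a) ≡ map inj₁ (replicate i a)
    replicate-inj₁ zero a = refl
    replicate-inj₁ (suc i) a = cong (inj₁ a ∷_) (replicate-inj₁ i a)

    module _ (bs : Bases) (κ : Fin (slots + slots) → ℕ) where

      spell-slot : ∀ s W → spell κ (slotPowers bs s ++ W) ≡ map inj₁ (slotWord bs κ s) ++ spell κ W
      spell-slot s W
        rewrite +-identityʳ (κ (s ↑ˡ slots) + 0) | +-identityʳ (κ (s ↑ˡ slots))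
              | +-identityʳ (κ (slots ↑ʳ s) + 0) | +-identityʳ (κ (slots ↑ʳ s))
              | replicate-inj₁ (κ (s ↑ˡ slots)) (proj₁ (lookup bs s))
              | replicate-inj₁ (κ (slots ↑ʳ s)) (proj₂ (lookup bs s))
              | map-++ (inj₁ {B = Fin n}) (replicate (κ (s ↑ˡ slots)) (proj₁ (lookup bs s))) (replicate (κ (slots ↑ʳ s)) (proj₂ (lookup bs s)))
        = sym (++-assoc (map inj₁ (replicate (κ (s ↑ˡ slots)) (proj₁ (lookup bs s)))) _ _)

      spell-popPowers : ∀ keep U → spell κ (popPowers keep bs U) ≡ popAll (popOf keep (slotWord bs κ)) U
      spell-popPowers keep [] = refl
      spell-popPowers keep (inj₁ a ∷ U) = cong (inj₁ a ∷_) (spell-popPowers keep U)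
      spell-popPowers keep (inj₂ x ∷ U) with lookup keep x
      ... | false = trans (spell-slot (left x) (popPowers keep bs U))
        (cong (map inj₁ (slotWord bs κ (left x)) ++_) (spell-popPowers keep U))
      ... | true = trans (spell-slot (left x) (symbol (inj₂ x) ∷ slotPowers bs (right x) ++ popPowers keep bs U)) (cong (λ W → map inj₁ (slotWord bs κ (left x)) ++ inj₂ x ∷ W)
        (trans (spell-slot (right x) (popPowers keep bs U))
          (cong (map inj₁ (slotWord bs κ (right x)) ++_) (spell-popPowers keep U))))

      spell-expandPowers : ∀ U → spell κ (expandPowers bs U) ≡ expand (slotWord bs κ ∘′ name) U
      spell-expandPowers [] = refl
      spell-expandPowers (inj₁ c ∷ U) = trans (spell-slot (name c) (expandPowers bs U))
        (cong (map inj₁ (slotWord bs κ (name c)) ++_) (spell-expandPowers U))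
      spell-expandPowers (inj₂ x ∷ U) = cong (inj₂ x ∷_) (spell-expandPowers U)

    slotWord-complete : (w : Fin slots → List A) → (∀ s → TwoPowers (w s)) →
      ∃₂ λ bs κ → ∀ s → slotWord bs κ s ≡ w s
    slotWord-complete w two = tabulate bases , κ , eq
      where
      bases : Fin slots → A × A
      bases s = proj₁ (two s)
      κ : Fin (slots + slots) → ℕ
      κ i = [ (λ s → proj₁ (proj₁ (proj₂ (two s)))) , (λ s → proj₂ (proj₁ (proj₂ (two s)))) ]′ (splitAt slots i)
      eq : ∀ s → slotWord (tabulate bases) κ s ≡ w s
      eq s rewrite splitAt-↑ˡ slots s slots | splitAt-↑ʳ slots slots s | lookup∘tabulate bases s = sym (proj₂ (proj₂ (two s)))

-- Short solutions and the compression step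

short : {A : Set} → List A → Maybe A
short [] = nothing
short (a ∷ _) = just a

short-word : {A : Set} → Maybe A → List A
short-word = maybe′ [_] []

-- Every variable occurring in `U` has a value of length at most one, so truncating all values
-- changes nothing.
apply-short : {A V : Set} (S : V → List A) (U : List (A ⊎ V)) → length (apply S U) ≤ 1 →
  apply (short-word ∘′ short ∘′ S) U ≡ apply S U
apply-short S [] _ = refl
apply-short S (inj₁ a ∷ U) (s≤s le) = cong (a ∷_) (apply-short S U (m≤n⇒m≤1+n le))
apply-short S (inj₂ x ∷ U) le with S x
... | [] = apply-short S U le
apply-short S (inj₂ x ∷ U) (s≤s le) | a ∷ [] = cong (a ∷_) (apply-short S U (m≤n⇒m≤1+n le))
apply-short S (inj₂ x ∷ U) (s≤s ()) | a ∷ b ∷ w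

count-++ : {A : Set} (J : A → A → Bool) (ps qs : List (A × A)) → count J (ps ++ qs) ≡ count J ps + count J qs
count-++ J [] qs = refl
count-++ J ((a , b) ∷ ps) qs = trans (cong (bit (J a b) +_) (count-++ J ps qs)) (sym (+-assoc (bit (J a b)) _ _))

positive-summand : ∀ i j → 0 < i + j → 0 < i ⊎ 0 < j
positive-summand zero j pos = inj₂ pos
positive-summand (suc i) j pos = inj₁ (s≤s z≤n)

-- Here `E` is the old size, `F` the size after joining `c` pairs, `X` the size including popped
-- factors, `p` the number of pairs, `v` the number of variable occurrences. The hypotheses give
-- `4 * X ≤ 3 * E + (2 + 10 * v)`: 2 and `2 * v` come from `length-adjacent` on both sides, `8 * v`
-- from four times the popped factors. So the bound persists once `M` is at least `2 + 10 * N`.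
size-stays-bounded : ∀ {X F E c p v M N} → X ≤ F + (v + v) → F + c ≡ E → E ≤ 2 + p + (v + v) → p ≤ 4 * c →
  E ≤ M → v ≤ N → 2 + 10 * N ≤ M → X ≤ M
size-stays-bounded {X} {F} {E} {c} {p} {v} {M} {N} hX refl hE hp hM hv hN =
  *-cancelˡ-≤ 4 (+-cancelˡ-≤ E _ _ (begin
    E + 4 * X                                 ≤⟨ +-mono-≤ hE (*-monoʳ-≤ 4 hX) ⟩
    (2 + p + (v + v)) + 4 * (F + (v + v))     ≤⟨ +-monoˡ-≤ _ (+-monoˡ-≤ (v + v) (+-monoʳ-≤ 2 hp)) ⟩
    (2 + 4 * c + (v + v)) + 4 * (F + (v + v)) ≡⟨ solve 3 (λ c v f → (con 2 :+ con 4 :* c :+ (v :+ v)) :+ con 4 :* (f :+ (v :+ v))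
                                                    := (f :+ c) :+ (con 3 :* (f :+ c) :+ (con 2 :+ con 10 :* v))) refl c v F ⟩
    E + (3 * E + (2 + 10 * v))                ≤⟨ +-monoʳ-≤ E (+-mono-≤ (*-monoʳ-≤ 3 hM) (≤-trans (+-monoʳ-≤ 2 (*-monoʳ-≤ 10 hv)) hN)) ⟩
    E + (3 * M + M)                           ≡⟨ cong (E +_) (solve 1 (λ m → con 3 :* m :+ m := con 4 :* m) refl M) ⟩
    E + 4 * M                                 ∎))
  where
  open ≤-Reasoning
  open +-*-Solver

module WordEquations (n k N M : ℕ) (M≤k : M ≤ suc k) (10N≤M : 2 + 10 * N ≤ M) where

  Letter Symbol : Set
  Letter = Fin (suc k)
  Symbol = Letter ⊎ Fin n

  Word : Set
  Word = List Symbol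

  open Slots n (suc k)
  open Parametric (_≟ˢ_ (_≟ᶠ_ {suc k}))

  State : Set
  State = Word × Word

  Sol : State → ℕ → Set
  Sol (U , V) m = ∃ λ S → apply S U ≡ apply S V × length (apply S U) ≡ m

  Base : State → Set
  Base (U , V) = ∃ λ (s : Vec (Maybe Letter) n) →
    apply (short-word ∘′ lookup s) U ≡ apply (short-word ∘′ lookup s) V

  base? : ∀ s → Dec (Base s)
  base? (U , V) = search (enum-Vec (enum-Maybe (enum-Fin (suc k))) n) λ s → List-≡-dec _≟ᶠ_ _ _

  Compresses : (π : Fin n → Pop Letter) (h : Letter → List Letter) → State → State → Set
  Compresses π h (U , V) (U′ , V′) = popAll π U ≡ expand h U′ × popAll π V ≡ expand h V′

  Step : State → State → Set
  Step (U , V) (U′ , V′) = ∃₂ λ (keep : Vec Bool n) (bs : Bases _≟ᶠ_) → ∃ λ κ →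
    All (Spells κ) ((popPowers _≟ᶠ_ keep bs U , expandPowers _≟ᶠ_ bs U′) ∷ (popPowers _≟ᶠ_ keep bs V , expandPowers _≟ᶠ_ bs V′) ∷ [])

  step? : ∀ s t → Dec (Step s t)
  step? (U , V) (U′ , V′) = search (enum-Vec enum-Bool n) λ keep →
    search (enum-Vec (enum-× (enum-Fin (suc k)) (enum-Fin (suc k))) slots) λ bs → parametric? _

  -- A solution of the target is decoded by `h` and the popped words are put back around each value.
  -- Only the two word identities enter, so `Step` can range over all words of the form aⁱbʲ.
  compresses-sound : ∀ {π h} s t → Compresses π h s t → ∃ (Sol t) → ∃ (Sol s)
  compresses-sound {π} {h} (U , V) (U′ , V′) (eqU , eqV) (_ , S′ , eq , _) = _ , S ,
    trans (lower U U′ eqU) (trans (cong (concatMap h) eq) (sym (lower V V′ eqV))) , refl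
    where
    S : Fin n → List Letter
    S x = refill (π x) (concatMap h (S′ x))
    lower : ∀ W W′ → popAll π W ≡ expand h W′ → apply S W ≡ concatMap h (apply S′ W′)
    lower W W′ w≡ = trans (sym (apply-popAll π (concatMap h ∘′ S′) W))
      (trans (cong (apply (concatMap h ∘′ S′)) w≡) (apply-expand h S′ W′))

  step-sound : ∀ {s t} → Step s t → ∃ (Sol t) → ∃ (Sol s)
  step-sound {U , V} {U′ , V′} (keep , bs , κ , eqU ∷ eqV ∷ []) =
    compresses-sound (U , V) (U′ , V′) (spelled U U′ eqU , spelled V V′ eqV)
    where
    spelled : ∀ W W′ → Spells κ (popPowers _≟ᶠ_ keep bs W , expandPowers _≟ᶠ_ bs W′) →
      popAll (popOf _≟ᶠ_ keep (slotWord _≟ᶠ_ bs κ)) W ≡ expand (slotWord _≟ᶠ_ bs κ ∘′ name) W′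
    spelled W W′ w≡ = trans (sym (spell-popPowers _≟ᶠ_ bs κ keep W)) (trans w≡ (spell-expandPowers _≟ᶠ_ bs κ W′))

  TwoPowerPop : Pop Letter → Set
  TwoPowerPop (u , m) = TwoPowers u × TwoPowers (maybe′ id [] m)

  -- Bases and exponents are read off the given decompositions. A variable that disappears gets the
  -- empty word, with both exponents zero, in its right slot.
  step-complete : ∀ {π h} → (∀ x → TwoPowerPop (π x)) → (∀ c → TwoPowers (h c)) →
    ∀ s t → Compresses π h s t → Step s t
  step-complete {π} {h} tπ th (U , V) (U′ , V′) (eqU , eqV)
    with slotWord-complete _≟ᶠ_ (assemble (λ x → proj₁ (π x)) (λ x → maybe′ id [] (proj₂ (π x))) h)
      (assemble-all _ _ h {TwoPowers} (λ x → proj₁ (tπ x)) (λ x → proj₂ (tπ x)) th)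
  ... | bs , κ , eq = keep , bs , κ , spelled U U′ eqU ∷ spelled V V′ eqV ∷ []
    where
    kept : Maybe (List Letter) → Bool
    kept = maybe′ (λ _ → true) false
    keep : Vec Bool n
    keep = tabulate (λ x → kept (proj₂ (π x)))
    rebuild : ∀ p {u b v} → u ≡ proj₁ p → b ≡ kept (proj₂ p) → v ≡ maybe′ id [] (proj₂ p) →
      (u , (if b then just v else nothing)) ≡ p
    rebuild (u , nothing) refl refl _ = refl
    rebuild (u , just v) refl refl refl = refl
    pops : ∀ x → popOf _≟ᶠ_ keep (slotWord _≟ᶠ_ bs κ) x ≡ π x
    pops x = rebuild (π x) (trans (eq (left x)) (assemble-left _ _ h x))
      (lookup∘tabulate (λ x → kept (proj₂ (π x))) x)
      (trans (eq (right x)) (assemble-right (λ x → proj₁ (π x)) _ h x))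
    spelled : ∀ W W′ → popAll π W ≡ expand h W′ → Spells κ (popPowers _≟ᶠ_ keep bs W , expandPowers _≟ᶠ_ bs W′)
    spelled W W′ w≡ = begin
      spell κ (popPowers _≟ᶠ_ keep bs W)                 ≡⟨ spell-popPowers _≟ᶠ_ bs κ keep W ⟩
      popAll (popOf _≟ᶠ_ keep (slotWord _≟ᶠ_ bs κ)) W    ≡⟨ popAll-cong pops W ⟩
      popAll π W                                         ≡⟨ w≡ ⟩
      expand h W′                                        ≡⟨ expand-cong (λ c → sym (trans (eq (name c)) (assemble-name _ _ h c))) W′ ⟩
      expand (slotWord _≟ᶠ_ bs κ ∘′ name) W′             ≡⟨ sym (spell-expandPowers _≟ᶠ_ bs κ W′) ⟩
      spell κ (expandPowers _≟ᶠ_ bs W′)                  ∎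
      where open ≡-Reasoning

  Inv : State → Set
  Inv (U , V) = length U + length V ≤ M × vars U + vars V ≤ N

  Shrinks : (Letter → Bool) → List Letter → Set
  Shrinks f w = length (Factorization.factors {Letter} {Fin n} (join f) w) < length w

  module Compression (f : Letter → Bool) {U V : Word} (inv : Inv (U , V))
    (many-joins : length (adjacent U ++ adjacent V) ≤ 4 * count (join f) (adjacent U ++ adjacent V))
    (S : Fin n → List Letter) (eq : apply S U ≡ apply S V)
    (shrinks : Shrinks f (apply S U)) where

    open Factorization {Letter} {Fin n} (join f)

    π : Fin n → Pop Letter
    π x = proj₁ (peel (factors (S x)))

    mid : Fin n → List (Factor Letter)
    mid x = proj₁ (proj₂ (peel (factors (S x))))

    peeled : ∀ x → Peel (factors (S x)) (π x) (mid x)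
    peeled x = proj₂ (proj₂ (peel (factors (S x))))

    U₁ V₁ : List (Factor Letter ⊎ Fin n)
    U₁ = factorsV (popAll π U)
    V₁ = factorsV (popAll π V)

    empty-twoPowers : TwoPowers {Letter} []
    empty-twoPowers = (zero , zero) , (0 , 0) , refl

    peel-twoPowers : ∀ {F p m} → All (Joined ∘′ letters) F → Peel F p m → TwoPowerPop p
    peel-twoPowers _ none = empty-twoPowers , empty-twoPowers
    peel-twoPowers (j ∷ _) (one f′) = joined-twoPowers f f′ j , empty-twoPowers
    peel-twoPowers (j ∷ js) (many f′ m g) = joined-twoPowers f f′ j , joined-twoPowers f g (All.head (++⁻ʳ m js))

    size-bound : length U₁ + length V₁ ≤ M
    size-bound = size-stays-bounded {F = length (factorsV U) + length (factorsV V)} {c = count (join f) (adjacent U ++ adjacent V)}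
      {v = vars U + vars V}
      (≤-trans (+-mono-≤ (length-factorsV-popAll S peeled U) (length-factorsV-popAll S peeled V))
        (≤-reflexive (solve 4 (λ a b u v → (a :+ (u :+ u)) :+ (b :+ (v :+ v)) := (a :+ b) :+ ((u :+ v) :+ (u :+ v))) refl
          (length (factorsV U)) (length (factorsV V)) (vars U) (vars V))))
      (trans (cong (length (factorsV U) + length (factorsV V) +_) (count-++ (join f) (adjacent U) (adjacent V)))
        (trans (solve 4 (λ a b u v → (a :+ b) :+ (u :+ v) := (a :+ u) :+ (b :+ v)) refl
          (length (factorsV U)) (length (factorsV V)) (count (join f) (adjacent U)) (count (join f) (adjacent V)))
        (cong₂ _+_ (length-factorsV U) (length-factorsV V))))
      (≤-trans (+-mono-≤ (length-adjacent U) (length-adjacent V))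
        (≤-reflexive (trans (solve 4 (λ a b u v → (con 1 :+ (a :+ (u :+ u))) :+ (con 1 :+ (b :+ (v :+ v)))
            := con 2 :+ (a :+ b) :+ ((u :+ v) :+ (u :+ v))) refl
          (length (adjacent U)) (length (adjacent V)) (vars U) (vars V))
          (cong (λ l → 2 + l + ((vars U + vars V) + (vars U + vars V))) (sym (length-++ (adjacent U)))))))
      many-joins (proj₁ inv) (proj₂ inv) 10N≤M
      where open +-*-Solver

    vars-bound : vars U₁ + vars V₁ ≤ N
    vars-bound = ≤-trans (+-mono-≤ (bound U) (bound V)) (proj₂ inv)
      where
      bound : ∀ W → vars (factorsV (popAll π W)) ≤ vars W
      bound W = ≤-trans (≤-reflexive (vars-factorsV (popAll π W))) (vars-popAll S peeled W)

    _≟ᶜ_ : DecidableEquality (Factor Letter)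
    _≟ᶜ_ = ×-≡-dec _≟ᶠ_ (List-≡-dec _≟ᶠ_)

    new-names : ∃₂ λ (ρ : Factor Letter → Maybe Letter) (h : Letter → Factor Letter) →
      (∀ {b} → b ∈ names U₁ ++ names V₁ → ∃ λ c → ρ b ≡ just c × h c ≡ b) × (∀ c → Joined (letters (h c)))
    -- The default is a factor of one letter, which is trivially joined. There are enough names, as
    -- the new equation has at most `M` symbols and `M ≤ suc k`.
    new-names = naming _≟ᶜ_ {b₀ = zero , []} [-]
      (++⁺ (factorsV-joined (popAll π U)) (factorsV-joined (popAll π V))) (suc k)
      (≤-trans (≤-reflexive (length-++ (names U₁))) (≤-trans (+-mono-≤ (length-names U₁) (length-names V₁))
        (≤-trans size-bound M≤k)))

    result : ∃ λ t → Step (U , V) t × Inv t × ∃ λ m → m < length (apply S U) × Sol t m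
    result with new-names
    ... | ρ , h , found , joined = (relabel ρ U₁ , relabel ρ V₁) ,
      step-complete (λ x → peel-twoPowers (factors-joined (S x)) (peeled x)) (λ c → joined-twoPowers f (h c) (joined c))
        (U , V) (relabel ρ U₁ , relabel ρ V₁)
        (expands U (λ b∈ → found (∈-++⁺ˡ b∈)) , expands V (λ b∈ → found (∈-++⁺ʳ (names U₁) b∈))) ,
      (≤-trans (+-mono-≤ (length-relabel ρ U₁) (length-relabel ρ V₁)) size-bound ,
       ≤-trans (≤-reflexive (cong₂ _+_ (vars-relabel ρ U₁) (vars-relabel ρ V₁))) vars-bound) ,
      length (apply S′ (relabel ρ U₁)) ,
      ≤-trans (s≤s (≤-trans (≤-reflexive (cong length (solution U))) (length-mapMaybe ρ (factors (apply S U))))) shrinks ,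
      S′ , trans (solution U) (trans (cong (mapMaybe ρ ∘′ factors) eq) (sym (solution V))) , refl
      where
      S′ : Fin n → List Letter
      -- Factors hidden inside the variables may have no name and are then erased; this can only
      -- shorten the solution further.
      S′ = mapMaybe ρ ∘′ mid
      solution : ∀ W → apply S′ (relabel ρ (factorsV (popAll π W))) ≡ mapMaybe ρ (factors (apply S W))
      solution W = trans (apply-relabel ρ mid (factorsV (popAll π W)))
        (cong (mapMaybe ρ) (proj₂ (apply-factorsV S peeled W)))
      expands : ∀ W → (∀ {b} → b ∈ names (factorsV (popAll π W)) → ∃ λ c → ρ b ≡ just c × h c ≡ b) →
        popAll π W ≡ expand (letters ∘′ h) (relabel ρ (factorsV (popAll π W)))
      expands W found′ = trans (sym (expand-factorsV (popAll π W)))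
        (sym (expand-relabel ρ h letters (factorsV (popAll π W)) found′))

  base-complete : ∀ {U V : Word} (S : Fin n → List Letter) → apply S U ≡ apply S V → length (apply S U) ≤ 1 → Base (U , V)
  base-complete {U} {V} S eq le = s , trans (short-solution U le)
    (trans eq (sym (short-solution V (subst (λ w → length w ≤ 1) eq le))))
    where
    s : Vec (Maybe Letter) n
    s = tabulate (short ∘′ S)
    short-solution : ∀ W → length (apply S W) ≤ 1 → apply (short-word ∘′ lookup s) W ≡ apply S W
    short-solution W l = trans (apply-cong (λ x → cong short-word (lookup∘tabulate (short ∘′ S) x)) W) (apply-short S W l)

  positive : ∀ {l c} → suc l ≤ 4 * c → 0 < c
  positive {c = suc c} _ = s≤s z≤n

  -- For equations without adjacent letters: the size bound then asks nothing of the labelling, but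
  -- the solution must still shrink, so the labelling is chosen to join the first two letters of the
  -- solution.
  first-pair-labelling : ∀ w → 1 < length w → ∃ λ f → Shrinks f w
  first-pair-labelling (a ∷ []) (s≤s ())
  first-pair-labelling (a ∷ b ∷ w) _ = let f , le = good-labelling ((a , b) ∷ []) in
    f , Factorization.length-factors< {Letter} {Fin n} (join f) (joins (join f a b) le) w
    where
    joins : ∀ j → 1 ≤ 4 * (bit j + 0) → j ≡ true
    joins true _ = refl

  labelling : ∀ {U V : Word} (S : Fin n → List Letter) → apply S U ≡ apply S V → 1 < length (apply S U) →
    ∃ λ f → length (adjacent U ++ adjacent V) ≤ 4 * count (join f) (adjacent U ++ adjacent V) × Shrinks f (apply S U)
  labelling {U} {V} S eq long = choose (adjacent U ++ adjacent V) refl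
    where
    shrinks : ∀ f → 0 < count (join f) (adjacent U) ⊎ 0 < count (join f) (adjacent V) → Shrinks f (apply S U)
    shrinks f (inj₁ pos) = Factorization.apply-shrinks {Letter} {Fin n} (join f) S U pos
    shrinks f (inj₂ pos) = subst (Shrinks f) (sym eq) (Factorization.apply-shrinks {Letter} {Fin n} (join f) S V pos)
    choose : ∀ ps → ps ≡ adjacent U ++ adjacent V → ∃ λ f → length ps ≤ 4 * count (join f) ps × Shrinks f (apply S U)
    choose [] _ = let f , s = first-pair-labelling (apply S U) long in f , z≤n , s
    choose (p ∷ ps) pairs = let f , le = good-labelling (p ∷ ps) in f , le ,
      shrinks f (positive-summand _ _ (subst (0 <_)
        (trans (cong (count (join f)) pairs) (count-++ (join f) (adjacent U) (adjacent V))) (positive le)))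

  complete : ∀ {s m} → Inv s → Sol s m → Base s ⊎ ∃ λ t → Step s t × Inv t × ∃ λ l → l < m × Sol t l
  complete {U , V} inv (S , eq , refl) with length (apply S U) ≤ⁿ? 1
  ... | yes le = inj₁ (base-complete {U} {V} S eq le)
  ... | no nle = let f , many-joins , shrinks = labelling {U} {V} S eq (≰⇒> nle) in
    inj₂ (Compression.result f {U} {V} inv many-joins S eq shrinks)

  symbols : Enumeration Symbol
  symbols = enum-⊎ (enum-Fin (suc k)) (enum-Fin n)

  covers : ∀ {s} → Inv s → s ∈ cartesianProduct (words≤ (proj₁ symbols) M) (words≤ (proj₁ symbols) M)
  covers {U , V} (le , _) = ∈-cartesianProduct⁺
    (∈-words≤ symbols M U (≤-trans (m≤m+n _ _) le)) (∈-words≤ symbols M V (≤-trans (m≤n+m _ (length U)) le))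

  solvable? : ∀ s → Inv s → Dec (∃ (Sol s))
  solvable? s = Saturation.decide base? step? {Sol} {Inv}
    (λ { {U , V} (s , eq) → length (apply (short-word ∘′ lookup s) U) , short-word ∘′ lookup s , eq , refl })
    (λ {s} {t} → step-sound {s} {t}) (λ {s} {m} → complete {s} {m})
    (cartesianProduct (words≤ (proj₁ symbols) M) (words≤ (proj₁ symbols) M)) (λ {s} → covers {s}) {s}

-- Positive existential formulas

toLetter : ∀ {k} → Bool → Fin (suc (suc k))
toLetter false = zero
toLetter true = suc zero

-- Any map of letters that fixes the constants carries solutions to solutions, so the letters beyond
-- the two bits may be sent anywhere.
fromLetter : ∀ {k} → Fin (suc (suc k)) → Bool
fromLetter zero = false
fromLetter (suc _) = true

from∘to : ∀ {k} b → fromLetter {k} (toLetter b) ≡ b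
from∘to false = refl
from∘to true = refl

recolour : {A B V : Set} → (A → B) → List (A ⊎ V) → List (B ⊎ V)
recolour g = map (⊎-map g id)

apply-recolour : {A B V : Set} (g : A → B) (S : V → List A) (U : List (A ⊎ V)) →
  apply (map g ∘′ S) (recolour g U) ≡ map g (apply S U)
apply-recolour g S [] = refl
apply-recolour g S (inj₁ a ∷ U) = cong (g a ∷_) (apply-recolour g S U)
apply-recolour g S (inj₂ x ∷ U) = trans (cong (map g (S x) ++_) (apply-recolour g S U)) (sym (map-++ g (S x) _))

recolour-inverse : {A B V : Set} {g : A → B} {h : B → A} → (∀ a → h (g a) ≡ a) → (U : List (A ⊎ V)) →
  recolour h (recolour g U) ≡ U
recolour-inverse inv [] = refl
recolour-inverse inv (inj₁ a ∷ U) = cong₂ _∷_ (cong inj₁ (inv a)) (recolour-inverse inv U)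
recolour-inverse inv (inj₂ x ∷ U) = cong (inj₂ x ∷_) (recolour-inverse inv U)

vars-recolour : {A B V : Set} (g : A → B) (U : List (A ⊎ V)) → vars (recolour g U) ≡ vars U
vars-recolour g [] = refl
vars-recolour g (inj₁ a ∷ U) = vars-recolour g U
vars-recolour g (inj₂ x ∷ U) = cong suc (vars-recolour g U)

BoolWord : ℕ → Set
BoolWord n = List (Bool ⊎ Fin n)

wordEquation? : ∀ {n} (U V : BoolWord n) → Dec (∃ λ (ρ : Env n) → apply ρ U ≡ apply ρ V)
wordEquation? {n} U V = map′
  (λ (_ , S , eq , _) → map fromLetter ∘′ S , to-Bool S eq)
  (λ (ρ , eq) → _ , map toLetter ∘′ ρ ,
    trans (apply-recolour toLetter ρ U) (trans (cong (map toLetter) eq) (sym (apply-recolour toLetter ρ V))) , refl)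
  (solvable? (U′ , V′) (≤-trans (≤-reflexive (cong₂ _+_ (length-map _ U) (length-map _ V))) (m≤m+n l _) ,
    ≤-reflexive (cong₂ _+_ (vars-recolour toLetter U) (vars-recolour toLetter V))))
  where
  N l M : ℕ
  N = vars U + vars V
  l = length U + length V
  -- Large enough both for the given equation and for `size-stays-bounded`; the alphabet has `M`
  -- letters and two more, so it contains both bits.
  M = l + (2 + 10 * N)
  U′ V′ : List (Fin (suc (suc M)) ⊎ Fin n)
  U′ = recolour toLetter U
  V′ = recolour toLetter V
  open WordEquations n (suc M) N M (m≤n+m M 2) (m≤n+m (2 + 10 * N) l)
  to-Bool : ∀ S → apply S U′ ≡ apply S V′ → apply (map fromLetter ∘′ S) U ≡ apply (map fromLetter ∘′ S) V
  to-Bool S eq = trans (back U) (trans (cong (map fromLetter) eq) (sym (back V)))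
    where
    back : ∀ W → apply (map fromLetter ∘′ S) W ≡ map fromLetter (apply S (recolour toLetter W))
    back W = trans (cong (apply (map fromLetter ∘′ S)) (sym (recolour-inverse from∘to W)))
      (apply-recolour fromLetter S (recolour toLetter W))

data Positive (n : ℕ) : Set where
  equation : BoolWord n → BoolWord n → Positive n
  both either : Positive n → Positive n → Positive n
  exists : Positive (suc n) → Positive n

Models : ∀ {n} → Positive n → Env n → Set
Models (equation U V) ρ = apply ρ U ≡ apply ρ V
Models (both φ ψ) ρ = Models φ ρ × Models ψ ρ
Models (either φ ψ) ρ = Models φ ρ ⊎ Models ψ ρ
Models (exists φ) ρ = ∃ λ x → Models φ (extend x ρ)

extend-cong : ∀ {n} {ρ ρ′ : Env n} x → (∀ i → ρ i ≡ ρ′ i) → ∀ i → extend x ρ i ≡ extend x ρ′ i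
extend-cong x eq zero = refl
extend-cong x eq (suc i) = eq i

Models-cong : ∀ {n} (φ : Positive n) {ρ ρ′ : Env n} → (∀ i → ρ i ≡ ρ′ i) → Models φ ρ → Models φ ρ′
Models-cong (equation U V) eq m = trans (sym (apply-cong eq U)) (trans m (apply-cong eq V))
Models-cong (both φ ψ) eq (m , m′) = Models-cong φ eq m , Models-cong ψ eq m′
Models-cong (either φ ψ) eq = ⊎-map (Models-cong φ eq) (Models-cong ψ eq)
Models-cong (exists φ) eq (x , m) = x , Models-cong φ (extend-cong x eq) m

-- Conjunctions as single equations

rename : {V W : Set} → (V → W) → List (Bool ⊎ V) → List (Bool ⊎ W)
rename r = map (⊎-map id r)

apply-rename : {V W : Set} (r : V → W) (ρ : W → BitString) (U : List (Bool ⊎ V)) → apply ρ (rename r U) ≡ apply (ρ ∘′ r) U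
apply-rename r ρ [] = refl
apply-rename r ρ (inj₁ a ∷ U) = cong (a ∷_) (apply-rename r ρ U)
apply-rename r ρ (inj₂ x ∷ U) = cong (ρ (r x) ++_) (apply-rename r ρ U)

++-injective : {A : Set} (x x′ : List A) {y y′ : List A} → length x ≡ length x′ → x ++ y ≡ x′ ++ y′ → x ≡ x′ × y ≡ y′
++-injective [] [] _ eq = refl , eq
++-injective (a ∷ x) (b ∷ x′) l eq =
  let eq₁ , eq₂ = ++-injective x x′ (suc-injective l) (∷-injectiveʳ eq) in cong₂ _∷_ (∷-injectiveˡ eq) eq₁ , eq₂

-- The two copies differ in one letter only, which marks the boundary between x and y.
tag : {X : Set} → (Bool → X) → List X → List X → List X
tag β x y = (x ++ β false ∷ y) ++ (x ++ β true ∷ y)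

untag : ∀ (x x′ : BitString) {y y′} → x ++ false ∷ y ≡ x′ ++ false ∷ y′ → x ++ true ∷ y ≡ x′ ++ true ∷ y′ → x ≡ x′ × y ≡ y′
untag [] [] eq _ = refl , ∷-injectiveʳ eq
untag [] (b ∷ x′) eq eq′ with trans (∷-injectiveˡ eq) (sym (∷-injectiveˡ eq′))
... | ()
untag (b ∷ x) [] eq eq′ with trans (sym (∷-injectiveˡ eq)) (∷-injectiveˡ eq′)
... | ()
untag (b ∷ x) (b′ ∷ x′) eq eq′ =
  let eq₁ , eq₂ = untag x x′ (∷-injectiveʳ eq) (∷-injectiveʳ eq′) in cong₂ _∷_ (∷-injectiveˡ eq) eq₁ , eq₂

length-mark : (x y : BitString) (b : Bool) → length (x ++ b ∷ y) ≡ length x + suc (length y)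
length-mark x y b = length-++ x

-- Both halves of a tagged word have the same length, so equal tagged words agree half by half, and
-- `untag` compares the positions of the marks.
tag-injective : ∀ x x′ {y y′ : BitString} → tag id x y ≡ tag id x′ y′ → x ≡ x′ × y ≡ y′
tag-injective x x′ {y} {y′} eq = let eq₁ , eq₂ = ++-injective (x ++ false ∷ y) (x′ ++ false ∷ y′) same eq in untag x x′ eq₁ eq₂
  where
  double : ∀ u v → length (tag id u v) ≡ length (u ++ false ∷ v) + length (u ++ false ∷ v)
  double u v = trans (length-++ (u ++ false ∷ v))
    (cong (length (u ++ false ∷ v) +_) (trans (length-mark u v true) (sym (length-mark u v false))))
  same : length (x ++ false ∷ y) ≡ length (x′ ++ false ∷ y′)
  same = m+m-injective _ _ (trans (sym (double x y)) (trans (cong length eq) (double x′ y′)))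

apply-tag : ∀ {n} (ρ : Env n) U W → apply ρ (tag inj₁ U W) ≡ tag id (apply ρ U) (apply ρ W)
apply-tag ρ U W = trans (apply-++ ρ (U ++ inj₁ false ∷ W) _)
  (cong₂ _++_ (apply-++ ρ U (inj₁ false ∷ W)) (apply-++ ρ U (inj₁ true ∷ W)))

-- The last argument is a continuation: processing φ introduces fresh variables and enlarges the equation,
-- after which Q remains to be decided.
satisfiable? : ∀ {k m} (φ : Positive k) (r : Fin k → Fin m) (U V : BoolWord m) (Q : Env m → Set) →
  (∀ {m′} (ι : Fin m → Fin m′) U′ V′ → Dec (∃ λ (ρ : Env m′) → apply ρ U′ ≡ apply ρ V′ × Q (ρ ∘′ ι))) →
  Dec (∃ λ (ρ : Env m) → apply ρ U ≡ apply ρ V × Models φ (ρ ∘′ r) × Q ρ)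
satisfiable? (equation W W′) r U V Q decide-rest =
  map′ (λ (ρ , eq , q) → let eq₁ , eq₂ = tag-injective (apply ρ U) (apply ρ V)
                               (trans (sym (apply-tag ρ U (rename r W))) (trans eq (apply-tag ρ V (rename r W′))))
           in ρ , eq₁ , trans (sym (apply-rename r ρ W)) (trans eq₂ (apply-rename r ρ W′)) , q)
       (λ (ρ , eq₁ , eq₂ , q) → ρ , trans (apply-tag ρ U (rename r W)) (trans (cong₂ (tag id) eq₁
           (trans (apply-rename r ρ W) (trans eq₂ (sym (apply-rename r ρ W′))))) (sym (apply-tag ρ V (rename r W′)))) , q)
       (decide-rest id (tag inj₁ U (rename r W)) (tag inj₁ V (rename r W′)))
satisfiable? (both φ ψ) r U V Q decide-rest =
  map′ (λ (ρ , eq , m , m′ , q) → ρ , eq , (m , m′) , q) (λ (ρ , eq , (m , m′) , q) → ρ , eq , m , m′ , q)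
    (satisfiable? φ r U V (λ ρ → Models ψ (ρ ∘′ r) × Q ρ) λ ι U′ V′ →
      satisfiable? ψ (ι ∘′ r) U′ V′ (λ ρ → Q (ρ ∘′ ι)) λ ι′ → decide-rest (ι′ ∘′ ι))
satisfiable? (either φ ψ) r U V Q decide-rest =
  map′ [ (λ (ρ , eq , m , q) → ρ , eq , inj₁ m , q) , (λ (ρ , eq , m , q) → ρ , eq , inj₂ m , q) ]′
    (λ { (ρ , eq , inj₁ m , q) → inj₁ (ρ , eq , m , q) ; (ρ , eq , inj₂ m , q) → inj₂ (ρ , eq , m , q) })
    (satisfiable? φ r U V Q decide-rest ⊎-dec satisfiable? ψ r U V Q decide-rest)
satisfiable? {k} {m} (exists φ) r U V Q decide-rest =
  map′ (λ (ρ , eq , mod , q) → ρ ∘′ suc ,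
         trans (sym (apply-rename suc ρ U)) (trans eq (apply-rename suc ρ V)) ,
         (ρ zero , Models-cong φ (λ { zero → refl ; (suc i) → refl }) mod) , q)
       (λ (ρ , eq , (x , mod) , q) → extend x ρ ,
         trans (apply-rename suc (extend x ρ) U) (trans eq (sym (apply-rename suc (extend x ρ) V))) ,
         Models-cong φ (λ { zero → refl ; (suc i) → refl }) mod , q)
       (satisfiable? φ r′ (rename suc U) (rename suc V) (λ ρ → Q (ρ ∘′ suc)) (λ ι → decide-rest (ι ∘′ suc)))
  where
  r′ : Fin (suc k) → Fin (suc m)
  r′ zero = zero
  r′ (suc i) = suc (r i)

positive? : (φ : Positive 0) → Dec (Models φ ε-env)
positive? φ = map′ (λ (ρ , _ , m , _) → Models-cong φ (λ ()) m) (λ m → ε-env , refl , Models-cong φ (λ ()) m , tt)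
  (satisfiable? φ (λ ()) [] [] (λ _ → ⊤) λ _ U V →
    map′ (λ (ρ , eq) → ρ , eq , tt) (λ (ρ , eq , _) → ρ , eq) (wordEquation? U V))

-- Negated atoms in positive form

data Clash (x y : BitString) : Set where
  longer : ∀ b z → x ≡ y ++ b ∷ z → Clash x y
  differ : ∀ p b q r → x ≡ p ++ b ∷ q → y ≡ p ++ not b ∷ r → Clash x y

clash-∷ : ∀ {x y} a → Clash x y → Clash (a ∷ x) (a ∷ y)
clash-∷ a (longer b z eq) = longer b z (cong (a ∷_) eq)
clash-∷ a (differ p b q r eq eq′) = differ (a ∷ p) b q r (cong (a ∷_) eq) (cong (a ∷_) eq′)

-- Reading both words from the left, the first place where `y` fails to match `x` is either the end
-- of `y` or a different bit.
⋠⇒clash : ∀ x y → ¬ (x ⪯ y) → Clash x y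
⋠⇒clash [] y n = contradiction (y , refl) n
⋠⇒clash (a ∷ x) [] n = longer a x refl
⋠⇒clash (false ∷ x) (false ∷ y) n = clash-∷ false (⋠⇒clash x y λ (z , eq) → n (z , cong (false ∷_) eq))
⋠⇒clash (true ∷ x) (true ∷ y) n = clash-∷ true (⋠⇒clash x y λ (z , eq) → n (z , cong (true ∷_) eq))
⋠⇒clash (false ∷ x) (true ∷ y) n = differ [] false x y refl refl
⋠⇒clash (true ∷ x) (false ∷ y) n = differ [] true x y refl refl

clash⇒⋠ : ∀ {x y} → Clash x y → ¬ (x ⪯ y)
clash⇒⋠ {y = []} (longer b z refl) (_ , ())
clash⇒⋠ {y = a ∷ y} (longer b z refl) (w , eq) = clash⇒⋠ (longer {y = y} b z refl) (w , ∷-injectiveʳ eq)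
clash⇒⋠ (differ [] false q r refl refl) (_ , ())
clash⇒⋠ (differ [] true q r refl refl) (_ , ())
clash⇒⋠ (differ (a ∷ p) b q r refl refl) (w , eq) = clash⇒⋠ (differ p b q r refl refl) (w , ∷-injectiveʳ eq)

≢⇒clash : ∀ x y → x ≢ y → Clash x y ⊎ Clash y x
≢⇒clash [] [] n = contradiction refl n
≢⇒clash [] (b ∷ y) n = inj₂ (longer b y refl)
≢⇒clash (a ∷ x) [] n = inj₁ (longer a x refl)
≢⇒clash (false ∷ x) (false ∷ y) n = ⊎-map (clash-∷ false) (clash-∷ false) (≢⇒clash x y (n ∘′ cong (false ∷_)))
≢⇒clash (true ∷ x) (true ∷ y) n = ⊎-map (clash-∷ true) (clash-∷ true) (≢⇒clash x y (n ∘′ cong (true ∷_)))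
≢⇒clash (false ∷ x) (true ∷ y) n = inj₁ (differ [] false x y refl refl)
≢⇒clash (true ∷ x) (false ∷ y) n = inj₁ (differ [] true x y refl refl)

clash⇒≢ : ∀ {x y} → Clash x y → x ≢ y
clash⇒≢ c refl = clash⇒⋠ c ([] , ++-identityʳ _)

word : ∀ {n} → Term n → BoolWord n
word (var i) = [ inj₂ i ]
word e = []
word 𝟘 = [ inj₁ false ]
word 𝟙 = [ inj₁ true ]
word (s ∘ t) = word s ++ word t

apply-word : ∀ {n} (t : Term n) (ρ : Env n) → apply ρ (word t) ≡ ⟦ t ⟧ ρ
apply-word (var i) ρ = ++-identityʳ (ρ i)
apply-word e ρ = refl
apply-word 𝟘 ρ = refl
apply-word 𝟙 ρ = refl
apply-word (s ∘ t) ρ = trans (apply-++ ρ (word s) (word t)) (cong₂ _++_ (apply-word s ρ) (apply-word t ρ))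

infix 4 _⇔_
_⇔_ : Set → Set → Set
P ⇔ Q = (P → Q) × (Q → P)

weaken : ∀ {n} → BoolWord n → BoolWord (suc n)
weaken = rename suc

prefix : ∀ {n} → BoolWord n → BoolWord n → Positive n
prefix U V = exists (equation (weaken U ++ inj₂ zero ∷ []) (weaken V))

prefix-correct : ∀ {n} (U V : BoolWord n) ρ → Models (prefix U V) ρ ⇔ (apply ρ U ⪯ apply ρ V)
prefix-correct U V ρ = (λ (z , eq) → z , trans (sym (lhs z)) (trans eq (apply-rename suc (extend z ρ) V))) ,
  (λ (z , eq) → z , trans (lhs z) (trans eq (sym (apply-rename suc (extend z ρ) V))))
  where
  lhs : ∀ z → apply (extend z ρ) (weaken U ++ inj₂ zero ∷ []) ≡ apply ρ U ++ z
  lhs z = trans (apply-++ (extend z ρ) (weaken U) _) (cong₂ _++_ (apply-rename suc (extend z ρ) U) (++-identityʳ z))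

longerBy : ∀ {n} → Bool → BoolWord n → BoolWord n → Positive n
longerBy b U V = exists (equation (weaken U) (weaken V ++ inj₁ b ∷ inj₂ zero ∷ []))

suc³ : ∀ {n} → Fin n → Fin (suc (suc (suc n)))
suc³ i = suc (suc (suc i))

-- The variables zero, one and two are the common prefix and the remainders of `U` and of `V`.
differBy : ∀ {n} → Bool → BoolWord n → BoolWord n → Positive n
differBy b U V = exists (exists (exists (both
  (equation (rename suc³ U) (inj₂ zero ∷ inj₁ b ∷ inj₂ (suc zero) ∷ []))
  (equation (rename suc³ V) (inj₂ zero ∷ inj₁ (not b) ∷ inj₂ (suc (suc zero)) ∷ [])))))

-- The bit in a `Clash` cannot be quantified inside an equation, so the disjunction runs over both
-- of its values.
clash : ∀ {n} → BoolWord n → BoolWord n → Positive n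
clash U V = either (either (longerBy false U V) (longerBy true U V)) (either (differBy false U V) (differBy true U V))

longerBy-correct : ∀ {n} b (U V : BoolWord n) ρ →
  Models (longerBy b U V) ρ ⇔ (∃ λ z → apply ρ U ≡ apply ρ V ++ b ∷ z)
longerBy-correct b U V ρ = (λ (z , eq) → z , trans (sym (apply-rename suc (extend z ρ) U)) (trans eq (rhs z))) ,
  (λ (z , eq) → z , trans (apply-rename suc (extend z ρ) U) (trans eq (sym (rhs z))))
  where
  rhs : ∀ z → apply (extend z ρ) (weaken V ++ inj₁ b ∷ inj₂ zero ∷ []) ≡ apply ρ V ++ b ∷ z
  rhs z = trans (apply-++ (extend z ρ) (weaken V) _)
    (cong₂ (λ v w → v ++ b ∷ w) (apply-rename suc (extend z ρ) V) (++-identityʳ z))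

differBy-correct : ∀ {n} b (U V : BoolWord n) ρ → Models (differBy b U V) ρ ⇔
  (∃ λ r → ∃ λ q → ∃ λ p → apply ρ U ≡ p ++ b ∷ q × apply ρ V ≡ p ++ not b ∷ r)
differBy-correct {n} b U V ρ =
  (λ (r , q , p , eq , eq′) → r , q , p ,
    trans (sym (apply-rename suc³ (env r q p) U)) (trans eq (rhs p b q)) ,
    trans (sym (apply-rename suc³ (env r q p) V)) (trans eq′ (rhs p (not b) r))) ,
  (λ (r , q , p , eq , eq′) → r , q , p ,
    trans (apply-rename suc³ (env r q p) U) (trans eq (sym (rhs p b q))) ,
    trans (apply-rename suc³ (env r q p) V) (trans eq′ (sym (rhs p (not b) r))))
  where
  env : ∀ r q p → Env (suc (suc (suc n)))
  env r q p = extend p (extend q (extend r ρ))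
  rhs : ∀ p c w → p ++ c ∷ w ++ [] ≡ p ++ c ∷ w
  rhs p c w = cong (λ v → p ++ c ∷ v) (++-identityʳ w)

clash-correct : ∀ {n} (U V : BoolWord n) ρ → Models (clash U V) ρ ⇔ Clash (apply ρ U) (apply ρ V)
clash-correct U V ρ = to , from
  where
  longer′ : ∀ b → Models (longerBy b U V) ρ → Clash (apply ρ U) (apply ρ V)
  longer′ b m = let z , eq = proj₁ (longerBy-correct b U V ρ) m in longer b z eq
  differ′ : ∀ b → Models (differBy b U V) ρ → Clash (apply ρ U) (apply ρ V)
  differ′ b m = let r , q , p , eq , eq′ = proj₁ (differBy-correct b U V ρ) m in differ p b q r eq eq′
  to : Models (clash U V) ρ → Clash (apply ρ U) (apply ρ V)
  to = [ [ longer′ false , longer′ true ]′ , [ differ′ false , differ′ true ]′ ]′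
  from : Clash (apply ρ U) (apply ρ V) → Models (clash U V) ρ
  from (longer false z eq) = inj₁ (inj₁ (proj₂ (longerBy-correct false U V ρ) (z , eq)))
  from (longer true z eq) = inj₁ (inj₂ (proj₂ (longerBy-correct true U V ρ) (z , eq)))
  from (differ p false q r eq eq′) = inj₂ (inj₁ (proj₂ (differBy-correct false U V ρ) (r , q , p , eq , eq′)))
  from (differ p true q r eq eq′) = inj₂ (inj₂ (proj₂ (differBy-correct true U V ρ) (r , q , p , eq , eq′)))

positive : ∀ {n} → PEForm n → Positive n
positive (s ≼ t) = prefix (word s) (word t)
positive (s ⋠ t) = clash (word s) (word t)
positive (s ≐ t) = equation (word s) (word t)
-- Words are equal exactly when each is a prefix of the other.
positive (s ≠ t) = either (clash (word s) (word t)) (clash (word t) (word s))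
positive (φ ∧ ψ) = both (positive φ) (positive ψ)
positive (φ ∨ ψ) = either (positive φ) (positive ψ)
positive (∃' φ) = exists (positive φ)
positive (∃≼ t φ) = exists (both (prefix [ inj₂ zero ] (weaken (word t))) (positive φ))

positive-correct : ∀ {n} (φ : PEForm n) ρ → Models (positive φ) ρ ⇔ Sat φ ρ
positive-correct (s ≼ t) ρ = subst₂ (λ x y → Models (prefix (word s) (word t)) ρ ⇔ (x ⪯ y))
  (apply-word s ρ) (apply-word t ρ) (prefix-correct (word s) (word t) ρ)
positive-correct (s ⋠ t) ρ = subst₂ (λ x y → Models (clash (word s) (word t)) ρ ⇔ (¬ (x ⪯ y)))
  (apply-word s ρ) (apply-word t ρ)
  (let to , from = clash-correct (word s) (word t) ρ in clash⇒⋠ ∘′ to , from ∘′ ⋠⇒clash _ _)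
positive-correct (s ≐ t) ρ = subst₂ (λ x y → (apply ρ (word s) ≡ apply ρ (word t)) ⇔ (x ≡ y))
  (apply-word s ρ) (apply-word t ρ) (id , id)
positive-correct (s ≠ t) ρ = subst₂ (λ x y → Models (positive (s ≠ t)) ρ ⇔ (x ≢ y))
  (apply-word s ρ) (apply-word t ρ)
  (let to , from = clash-correct (word s) (word t) ρ
       to′ , from′ = clash-correct (word t) (word s) ρ
   in [ clash⇒≢ ∘′ to , (λ m → clash⇒≢ (to′ m) ∘′ sym) ]′ , ⊎-map from from′ ∘′ ≢⇒clash _ _)
positive-correct (φ ∧ ψ) ρ = let to , from = positive-correct φ ρ ; to′ , from′ = positive-correct ψ ρ in
  (λ (m , m′) → to m , to′ m′) , (λ (s , s′) → from s , from′ s′)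
positive-correct (φ ∨ ψ) ρ = let to , from = positive-correct φ ρ ; to′ , from′ = positive-correct ψ ρ in
  ⊎-map to to′ , ⊎-map from from′
positive-correct (∃' φ) ρ = (λ (x , m) → x , proj₁ (positive-correct φ (extend x ρ)) m) ,
  (λ (x , s) → x , proj₂ (positive-correct φ (extend x ρ)) s)
positive-correct (∃≼ t φ) ρ =
  (λ (x , m , m′) → x , proj₁ (bound x) m , proj₁ (positive-correct φ (extend x ρ)) m′) ,
  (λ (x , s , s′) → x , proj₂ (bound x) s , proj₂ (positive-correct φ (extend x ρ)) s′)
  where
  bound : ∀ x → Models (prefix [ inj₂ zero ] (weaken (word t))) (extend x ρ) ⇔ (x ⪯ ⟦ t ⟧ ρ)
  bound x = subst₂ (λ y z → Models (prefix [ inj₂ zero ] (weaken (word t))) (extend x ρ) ⇔ (y ⪯ z))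
    (++-identityʳ x) (trans (apply-rename suc (extend x ρ) (word t)) (apply-word t ρ))
    (prefix-correct [ inj₂ zero ] (weaken (word t)) (extend x ρ))

theorem13 : (φ : PEForm 0) → Dec (𝔇⊨ φ)
theorem13 φ = let to , from = positive-correct φ ε-env in map′ to from (positive? (positive φ))
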